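{- Let $\Gamma$ be a finite connected simple graph. Then $C_3(L(\Gamma))\cong\Gamma$ if and only if all of the following hold: (1) every vertex of $\Gamma$ has degree $2$ or $3$; (2) every vertex of degree $2$ in $\Gamma$ is contained in a triangle; (3) every triangle in $\Gamma$ contains exactly one vertex of degree $2$; (4) distinct triangles in $\Gamma$ share no vertices.
   Context: The line graph $L(\Gamma)$ has the edges of $\Gamma$ as vertices, two being adjacent iff they share an endpoint in $\Gamma$. For a graph $H$, $C_3(H)$ is the graph whose vertices are the triangles (cliques of order 3) of $H$, two distinct triangles being adjacent iff they share at least one vertex. -}

module Defs where

open import Level using (0ℓ)
open import Data.Nat using (ℕ; _+_; _≡ᵇ_)
open import Data.Fin using (Fin)
open import Data.Bool using (Bool; true; false; if_then_else_)
open import Data.List using (List; map; allFin)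
open import Data.Nat.ListAction using (sum)
open import Data.Product using (Σ; _×_; _,_; proj₁; proj₂)
open import Data.Sum using (_⊎_; inj₁; inj₂)
open import Relation.Nullary using (¬_)
open import Relation.Binary using (IsEquivalence)
open import Relation.Binary.PropositionalEquality using (_≡_; refl; sym; trans; isEquivalence; subst₂)
open import Relation.Binary.Construct.Closure.ReflexiveTransitive using (Star)

-- Simple graphs on a setoid of vertices (used for L(Γ) and C₃(H),
-- whose vertices are unordered pairs / 3-sets, i.e. ordered tuples up
-- to "same underlying set").

record Graph : Set₁ where
  field
    V       : Set
    _≈_     : V → V → Set
    ≈-equiv : IsEquivalence _≈_
    Adj     : V → V → Set
    Adj-resp : ∀ {x x' y y'} → x ≈ x' → y ≈ y' → Adj x y → Adj x' y'
    Adj-sym : ∀ {x y} → Adj x y → Adj y x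
    Adj-irr : ∀ {x y} → Adj x y → ¬ (x ≈ y)

open Graph public

record _≅_ (G H : Graph) : Set where
  field
    to        : V G → V H
    from      : V H → V G
    to-cong   : ∀ {x y} → _≈_ G x y → _≈_ H (to x) (to y)
    from-cong : ∀ {x y} → _≈_ H x y → _≈_ G (from x) (from y)
    from-to   : ∀ x → _≈_ G (from (to x)) x
    to-from   : ∀ y → _≈_ H (to (from y)) y
    adj-to    : ∀ {x y} → Adj G x y → Adj H (to x) (to y)
    adj-from  : ∀ {x y} → Adj H (to x) (to y) → Adj G x y

module _ (G : Graph) where
  private
    _≈G_ = _≈_ G
    module E = IsEquivalence (≈-equiv G)

  record Edge : Set where
    constructor edge
    field
      e₁ e₂ : V G
      adj   : Adj G e₁ e₂

  _∈E_ : V G → Edge → Set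
  x ∈E e = (x ≈G Edge.e₁ e) ⊎ (x ≈G Edge.e₂ e)

  _≈E_ : Edge → Edge → Set
  e ≈E e' = ∀ x → (x ∈E e → x ∈E e') × (x ∈E e' → x ∈E e)

  record Triangle : Set where
    constructor tri
    field
      t₁ t₂ t₃ : V G
      a₁₂ : Adj G t₁ t₂
      a₂₃ : Adj G t₂ t₃
      a₃₁ : Adj G t₃ t₁

  _∈T_ : V G → Triangle → Set
  x ∈T t = (x ≈G Triangle.t₁ t) ⊎ (x ≈G Triangle.t₂ t) ⊎ (x ≈G Triangle.t₃ t)

  _≈T_ : Triangle → Triangle → Set
  t ≈T t' = ∀ x → (x ∈T t → x ∈T t') × (x ∈T t' → x ∈T t)

private
  setEq : {A X : Set} (_∈_ : X → A → Set) →
          IsEquivalence (λ (a b : A) → ∀ x → (x ∈ a → x ∈ b) × (x ∈ b → x ∈ a))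
  setEq _ = record
    { refl  = λ x → (λ p → p) , (λ p → p)
    ; sym   = λ p x → proj₂ (p x) , proj₁ (p x)
    ; trans = λ p q x → (λ r → proj₁ (q x) (proj₁ (p x) r))
                      , (λ r → proj₂ (p x) (proj₂ (q x) r))
    }

  module ShareAdj (A X : Set) (_∈_ : X → A → Set) where
    _~_ : A → A → Set
    a ~ b = ∀ x → (x ∈ a → x ∈ b) × (x ∈ b → x ∈ a)

    ShAdj : A → A → Set
    ShAdj a b = ¬ (a ~ b) × Σ X (λ x → (x ∈ a) × (x ∈ b))

    resp : ∀ {a a' b b'} → a ~ a' → b ~ b' → ShAdj a b → ShAdj a' b'
    resp {a} {a'} {b} {b'} p q (ne , x , xa , xb) =
      (λ r → ne (λ y → (λ s → proj₂ (q y) (proj₁ (r y) (proj₁ (p y) s)))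
                      , (λ s → proj₂ (p y) (proj₂ (r y) (proj₁ (q y) s)))))
      , x , proj₁ (p x) xa , proj₁ (q x) xb

    symA : ∀ {a b} → ShAdj a b → ShAdj b a
    symA (ne , x , xa , xb) =
      (λ r → ne (λ y → proj₂ (r y) , proj₁ (r y))) , x , xb , xa

    irrA : ∀ {a b} → ShAdj a b → ¬ (a ~ b)
    irrA = proj₁

L : Graph → Graph
L G = record
  { V = Edge G
  ; _≈_ = _≈E_ G
  ; ≈-equiv = setEq (_∈E_ G)
  ; Adj = ShAdj
  ; Adj-resp = λ {a} {a'} {b} {b'} → resp {a} {a'} {b} {b'}
  ; Adj-sym = λ {a} {b} → symA {a} {b}
  ; Adj-irr = λ {a} {b} → irrA {a} {b}
  }
  where open ShareAdj (Edge G) (V G) (_∈E_ G)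

C₃ : Graph → Graph
C₃ H = record
  { V = Triangle H
  ; _≈_ = _≈T_ H
  ; ≈-equiv = setEq (_∈T_ H)
  ; Adj = ShAdj
  ; Adj-resp = λ {a} {a'} {b} {b'} → resp {a} {a'} {b} {b'}
  ; Adj-sym = λ {a} {b} → symA {a} {b}
  ; Adj-irr = λ {a} {b} → irrA {a} {b}
  }
  where open ShareAdj (Triangle H) (V H) (_∈T_ H)

record FinGraph : Set where
  field
    n     : ℕ
    E     : Fin n → Fin n → Bool
    E-sym : ∀ i j → E i j ≡ E j i
    E-irr : ∀ i → E i i ≡ false

open FinGraph public

toGraph : FinGraph → Graph
toGraph Γ = record
  { V = Fin (n Γ)
  ; _≈_ = _≡_
  ; ≈-equiv = isEquivalence
  ; Adj = λ i j → E Γ i j ≡ true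
  ; Adj-resp = λ p q a → subst₂ (λ i j → E Γ i j ≡ true) p q a
  ; Adj-sym = λ {i} {j} a → trans (E-sym Γ j i) a
  ; Adj-irr = λ {i} a eq → irr eq a
  }
  where
    irr : ∀ {i j} → i ≡ j → E Γ i j ≡ true → _
    irr {i} refl a with trans (sym a) (E-irr Γ i)
    ... | ()

degree : (Γ : FinGraph) → Fin (n Γ) → ℕ
degree Γ i = sum (map (λ j → if E Γ i j then 1 else 0) (allFin (n Γ)))

Connected : FinGraph → Set
Connected Γ = ∀ (u v : Fin (n Γ)) → Star (λ i j → E Γ i j ≡ true) u v

deg2 : (Γ : FinGraph) → Fin (n Γ) → ℕ
deg2 Γ v = if degree Γ v ≡ᵇ 2 then 1 else 0

Cond1 : FinGraph → Set
Cond1 Γ = ∀ v → (degree Γ v ≡ 2) ⊎ (degree Γ v ≡ 3)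

Cond2 : FinGraph → Set
Cond2 Γ = ∀ v → degree Γ v ≡ 2 → Σ (Triangle (toGraph Γ)) (λ t → _∈T_ (toGraph Γ) v t)

-- the three vertices of a triangle are pairwise distinct, so this counts
-- the vertices of degree 2 in the triangle
Cond3 : FinGraph → Set
Cond3 Γ = ∀ (t : Triangle (toGraph Γ)) →
  deg2 Γ (Triangle.t₁ t) + deg2 Γ (Triangle.t₂ t) + deg2 Γ (Triangle.t₃ t) ≡ 1

Cond4 : FinGraph → Set
Cond4 Γ = ∀ (t t' : Triangle (toGraph Γ)) → ¬ (_≈T_ (toGraph Γ) t t') →
  ¬ Σ (Fin (n Γ)) (λ x → _∈T_ (toGraph Γ) x t × _∈T_ (toGraph Γ) x t')

{-# OPTIONS --safe #-}

-- A triangle of L(Γ) consists of the edges of a triangle of Γ or of three edges at one vertex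
-- (a claw).  Let C₃(L(Γ)) ≅ Γ.
--
-- All degrees are at most 3: replacing one edge of a claw at a vertex of degree d gives 3(d − 3)
-- claws adjacent to it, more than d once d ≥ 5, so degrees would grow without bound; and the four
-- claws at a vertex of degree 4 give a K₄ in Γ, a face of which has 6 neighbours in C₃(L(Γ)).
--
-- Now the claws, forming a set Q, induce in C₃(L(Γ)) a copy of the subgraph of Γ induced by the
-- set H of vertices of degree 3.  Hence the set P of triangles has the same size as the set L of
-- vertices of degree at most 2, and e(P) + e(P,Q) = e(L) + e(L,H).  Here e(P,Q) is the number of
-- incidences between triangles and H, so if r(u) ≤ 1 is the number of triangles through u ∈ L,
-- then e(P,Q) = 3|P| − Σ r(u) = Σ (3 − r(u)) ≥ Σ deg(u) = 2 e(L) + e(L,H), sums over u ∈ L.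
-- So e(P) = e(L) = 0, and every u ∈ L has degree 2 and lies on exactly one triangle.  Triangles
-- with a common vertex would be adjacent in P, and no triangle has two vertices in L; as
-- Σ r(u) = |L| = |P|, each has exactly one.
--
-- Conversely, send a vertex of degree 3 to its claw and one of degree 2 to its triangle.
module Submission where

open import Defs
open import Data.Bool.Base using (true; false; if_then_else_; Bool)
import Data.Bool.Properties as Bool
open import Data.Bool.Properties using (T-≡)
open import Data.Fin.Base using (Fin; zero; suc; combine; inject≤; join; punchIn; punchOut;
  remQuot; splitAt; _↑ˡ_)
open import Data.Fin.Properties using (_≟_; all?; any?; combine-remQuot; inject≤-injective;
  injective⇒≤; join-splitAt; punchIn-injective; punchIn-punchOut; punchInᵢ≢i; suc-injective;
  ↑ˡ-injective)
import Data.List.Base as List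
open import Data.List.Base using (List; []; _∷_; allFin; filterᵇ; length; lookup; tabulate)
open import Data.List.Membership.Propositional using (_∈_)
open import Data.List.Membership.Propositional.Properties using (∈-allFin; ∈-filter⁺; ∈-filter⁻;
  ∈-lookup)
open import Data.List.Properties using (map-tabulate)
import Data.List.Relation.Unary.All as All
open import Data.List.Relation.Unary.AllPairs using (_∷_)
open import Data.List.Relation.Unary.Any using (index)
open import Data.List.Relation.Unary.Any.Properties using (lookup-index)
open import Data.List.Relation.Unary.Unique.Propositional using (Unique)
open import Data.List.Relation.Unary.Unique.Propositional.Properties using (allFin⁺; filter⁺)
open import Data.Nat.Base using (ℕ; zero; suc; _≤_; _+_; _*_; z≤n; s≤s⁻¹; _≡ᵇ_)
import Data.Nat.ListAction as ListAction
import Data.Nat.Properties as ℕ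
open import Data.Nat.Properties using (*-cancelˡ-≡; *-distribʳ-+; *-distribˡ-+; *-identityʳ;
  *-identityˡ; *-mono-≤; *-monoʳ-≤; *-zeroʳ; +-assoc; +-cancelʳ-≡; +-cancelʳ-≤; +-cancelˡ-≡;
  +-cancelˡ-≤; +-comm; +-identityʳ; +-mono-≤; +-monoʳ-≤; +-monoˡ-≤; 0≢1+n; <⇒≱; m+n≡0⇒m≡0;
  m+n≡0⇒n≡0; m≤m+n; m≤n+m; m≤n⇒∃[o]m+o≡n; n≤1+n; ≤-antisym; ≤-refl; ≤-reflexive; ≤-trans; ≤∧≢⇒<;
  ≮⇒≥; module ≤-Reasoning)
open import Data.Nat.Tactic.RingSolver using (solve-∀)
open import Data.Product using (Σ; ∃; ∃₂; _×_; _,_; proj₁; proj₂; uncurry)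
import Data.Sum as Sum
open import Data.Sum using (_⊎_; inj₁; inj₂; [_,_])
import Data.Vec.Functional as VF
open import Data.Vec.Functional.Properties using (updateAt-minimal; updateAt-updates)
open import Function.Base using (_∘_; const)
open import Function.Bundles using (Equivalence; _⇔_; mk⇔)
open import Function.Definitions using (Injective)
open import Relation.Binary using (IsEquivalence)
open import Relation.Binary.PropositionalEquality using (_≡_; _≢_; refl; sym; trans; cong; cong₂;
  subst; subst₂; module ≡-Reasoning)
open import Relation.Nullary using (¬_; ¬?; Dec; yes; no; does; contradiction)
open import Relation.Nullary.Decidable using (T?; _×-dec_; _⊎-dec_; from-yes)
open import Algebra.Properties.Semiring.Sum ℕ.+-*-semiring
  using (sum; sum-cong-≗; ∑-distrib-+; ∑-comm; *-distribˡ-sum; *-distribʳ-sum)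

-- Injections from finite index sets, and counting with lists

module _ {A : Set} where

  Inj : ∀ {m} → (Fin m → A) → Set
  Inj = Injective _≡_ _≡_

  []-injective : Inj {0} VF.[]
  []-injective {()}

  ∷-injective : ∀ {m} {x : A} {f : Fin m → A} → (∀ i → x ≢ f i) → Inj f → Inj (x VF.∷ f)
  ∷-injective ne inj {zero}  {zero}  eq = refl
  ∷-injective ne inj {zero}  {suc j} eq = contradiction eq (ne j)
  ∷-injective ne inj {suc i} {zero}  eq = contradiction (sym eq) (ne i)
  ∷-injective ne inj {suc i} {suc j} eq = cong suc (inj eq)

  lookup-injective : ∀ {xs : List A} → Unique xs → Inj (lookup xs)
  lookup-injective {x ∷ xs} (x∉ ∷ u) {zero}  {zero}  eq = refl
  lookup-injective {x ∷ xs} (x∉ ∷ u) {zero}  {suc j} eq = contradiction eq (All.lookup x∉ (∈-lookup j))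
  lookup-injective {x ∷ xs} (x∉ ∷ u) {suc i} {zero}  eq = contradiction (sym eq) (All.lookup x∉ (∈-lookup i))
  lookup-injective {x ∷ xs} (x∉ ∷ u) {suc i} {suc j} eq = cong suc (lookup-injective u eq)

  sum-indicator : ∀ (p : A → Bool) xs →
                  ListAction.sum (List.map (λ a → if p a then 1 else 0) xs) ≡ length (filterᵇ p xs)
  sum-indicator p [] = refl
  sum-indicator p (x ∷ xs) with p x
  ... | true  = cong suc (sum-indicator p xs)
  ... | false = sum-indicator p xs

-- Neighbourhoods and degrees

module Neighbours (Γ : FinGraph) where

  Vx : Set
  Vx = Fin (n Γ)

  infix 4 _~_
  _~_ : Vx → Vx → Set
  i ~ j = E Γ i j ≡ true

  ~-sym : ∀ {i j} → i ~ j → j ~ i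
  ~-sym {i} {j} = Adj-sym (toGraph Γ) {i} {j}

  ~⇒≢ : ∀ {i j} → i ~ j → i ≢ j
  ~⇒≢ {i} {j} = Adj-irr (toGraph Γ) {i} {j}

  nbrs : Vx → List Vx
  nbrs v = filterᵇ (E Γ v) (allFin (n Γ))

  nbrs-unique : ∀ v → Unique (nbrs v)
  nbrs-unique v = filter⁺ (T? ∘ E Γ v) (allFin⁺ (n Γ))

  degree≡length : ∀ v → degree Γ v ≡ length (nbrs v)
  degree≡length v = sum-indicator (E Γ v) (allFin (n Γ))

  ∈-nbrs⁺ : ∀ {v w} → v ~ w → w ∈ nbrs v
  ∈-nbrs⁺ {v} {w} a = ∈-filter⁺ (T? ∘ E Γ v) (∈-allFin w) (Equivalence.from T-≡ a)

  ∈-nbrs⁻ : ∀ {v w} → w ∈ nbrs v → v ~ w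
  ∈-nbrs⁻ {v} {w} w∈ = Equivalence.to T-≡ (proj₂ (∈-filter⁻ (T? ∘ E Γ v) {xs = allFin (n Γ)} w∈))

  -- Together with `≤degree⇒injection` this replaces the sum defining `degree` by injections into
  -- the neighbourhood. Here `g i` is sent to its position in `nbrs v`.
  injection⇒≤degree : ∀ {m v} {g : Fin m → Vx} → Inj g → (∀ i → v ~ g i) → m ≤ degree Γ v
  injection⇒≤degree {m} {v} {g} inj adj = subst (m ≤_) (sym (degree≡length v))
    (injective⇒≤ {f = ix} λ {i} {j} eq → inj
      (trans (lookup-index (w∈ i)) (trans (cong (lookup (nbrs v)) eq) (sym (lookup-index (w∈ j))))))
    where
    w∈ : ∀ i → g i ∈ nbrs v
    w∈ i = ∈-nbrs⁺ (adj i)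
    ix : Fin m → Fin (length (nbrs v))
    ix i = index (w∈ i)

  ≤degree⇒injection : ∀ {m v} → m ≤ degree Γ v →
                      Σ (Fin m → Vx) λ g → Inj g × (∀ i → v ~ g i)
  ≤degree⇒injection {m} {v} m≤ =
    (λ i → lookup (nbrs v) (inject≤ i m≤l)) ,
    (λ eq → inject≤-injective m≤l m≤l _ _ (lookup-injective (nbrs-unique v) eq)) ,
    (λ i → ∈-nbrs⁻ (∈-lookup (inject≤ i m≤l)))
    where
    m≤l : m ≤ length (nbrs v)
    m≤l = subst (m ≤_) (degree≡length v) m≤

  degree≤n : ∀ v → degree Γ v ≤ n Γ
  degree≤n v with g , inj , _ ← ≤degree⇒injection {degree Γ v} {v} (≤-reflexive refl) = injective⇒≤ inj

  -- A neighbour outside the range of `g` would extend `g` to an injection of `suc m` neighbours.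
  nbrs-exhausted : ∀ {m v} {g : Fin m → Vx} → Inj g → (∀ i → v ~ g i) → degree Γ v ≤ m →
                   ∀ {x} → v ~ x → ∃ λ i → x ≡ g i
  nbrs-exhausted {m} {v} {g} inj adj d≤m {x} a with any? (λ i → x ≟ g i)
  ... | yes p = p
  ... | no ¬p = contradiction d≤m
    (<⇒≱ (injection⇒≤degree (∷-injective (λ i eq → ¬p (i , eq)) inj) λ { zero → a ; (suc i) → adj i }))

-- Triangles of the line graph

module Geometry (Γ : FinGraph) where
  open Neighbours Γ public

  G LG : Graph
  G  = toGraph Γ
  LG = L G

  pattern 1st = inj₁ refl
  pattern 2nd = inj₂ (inj₁ refl)
  pattern 3rd = inj₂ (inj₂ refl)

  infix 4 _∈△_ _∈△?_
  _∈△_ : Vx → Triangle G → Set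
  _∈△_ = _∈T_ G

  _∈△?_ : ∀ v T → Dec (v ∈△ T)
  v ∈△? tri a b c _ _ _ = (v ≟ a) ⊎-dec (v ≟ b) ⊎-dec (v ≟ c)

  -- `_≈E_` forgets the orientation that an `Edge` carries. Matching on `Joins a b e` recovers both
  -- endpoints of `e`, whichever way it points.
  data Joins (a b : Vx) : Edge G → Set where
    fwd : ∀ {p} → Joins a b (edge a b p)
    bwd : ∀ {p} → Joins a b (edge b a p)

  joins : ∀ {a b} (p : a ~ b) → Joins a b (edge a b p)
  joins p = fwd

  joins-sym : ∀ {a b e} → Joins a b e → Joins b a e
  joins-sym fwd = bwd
  joins-sym bwd = fwd

  joins-∈ : ∀ {a b e} → Joins a b e → _∈E_ G a e
  joins-∈ fwd = inj₁ refl
  joins-∈ bwd = inj₂ refl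

  joins-~ : ∀ {a b e} → Joins a b e → a ~ b
  joins-~ (fwd {p}) = p
  joins-~ (bwd {p}) = ~-sym p

  joins-through : ∀ {a} e → _∈E_ G a e → ∃ λ b → Joins a b e
  joins-through (edge a b p) (inj₁ refl) = b , fwd
  joins-through (edge b a p) (inj₂ refl) = b , bwd

  joins-≈ : ∀ {a b e e'} → Joins a b e → Joins a b e' → _≈E_ G e e'
  joins-≈ fwd fwd x = (λ z → z) , (λ z → z)
  joins-≈ fwd bwd x = [ inj₂ , inj₁ ] , [ inj₂ , inj₁ ]
  joins-≈ bwd fwd x = [ inj₂ , inj₁ ] , [ inj₂ , inj₁ ]
  joins-≈ bwd bwd x = (λ z → z) , (λ z → z)

  joins-resp : ∀ {a b e} e' → Joins a b e → _≈E_ G e e' → Joins a b e'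
  joins-resp {a} {b} e' j eq
    with joins-through e' (proj₁ (eq a) (joins-∈ j)) | proj₁ (eq b) (joins-∈ (joins-sym j))
  ... | _ , fwd {p} | inj₁ refl = contradiction refl (~⇒≢ (joins-~ j))
  ... | _ , fwd {p} | inj₂ refl = fwd
  ... | _ , bwd {p} | inj₁ refl = bwd
  ... | _ , bwd {p} | inj₂ refl = contradiction refl (~⇒≢ (joins-~ j))

  joins-unique : ∀ {a b c e} → Joins a b e → Joins a c e → b ≡ c
  joins-unique fwd fwd = refl
  joins-unique fwd (bwd {p}) = contradiction refl (~⇒≢ p)
  joins-unique bwd (fwd {p}) = contradiction refl (~⇒≢ p)
  joins-unique bwd bwd = refl

  infix 4 _≈△_ _≈L_
  _≈△_ : Triangle G → Triangle G → Set
  _≈△_ = _≈T_ G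

  _≈L_ : Triangle LG → Triangle LG → Set
  _≈L_ = _≈T_ LG

  ≈L-sym : ∀ s t → s ≈L t → t ≈L s
  ≈L-sym s t p x = proj₂ (p x) , proj₁ (p x)

  ≈L-trans : ∀ s t u → s ≈L t → t ≈L u → s ≈L u
  ≈L-trans s t u p q x = (λ r → proj₁ (q x) (proj₁ (p x) r)) , (λ r → proj₂ (p x) (proj₂ (q x) r))

  ~L-resp : ∀ {s s' t t'} → s ≈L s' → t ≈L t' → Adj (C₃ LG) s t → Adj (C₃ LG) s' t'
  ~L-resp {s} {s'} {t} {t'} = Adj-resp (C₃ LG) {s} {s'} {t} {t'}

  record Claw (v : Vx) : Set where
    constructor mkClaw
    field
      leg     : Fin 3 → Vx
      leg-~   : ∀ i → v ~ leg i
      leg-inj : Inj leg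

  open Claw public

  clawL : ∀ {v} → Claw v → Triangle LG
  clawL {v} (mkClaw x a inj) = tri (arm 0F) (arm 1F) (arm 2F) (meet (λ ())) (meet (λ ())) (meet (λ ()))
    where
    0F 1F 2F : Fin 3
    0F = zero
    1F = suc zero
    2F = suc (suc zero)
    arm : Fin 3 → Edge G
    arm i = edge v (x i) (a i)
    meet : ∀ {i j} → i ≢ j → Adj LG (arm i) (arm j)
    meet {i} {j} i≢j =
      (λ eq → i≢j (inj (joins-unique {e = arm j} (joins-resp (arm j) (fwd {p = a i}) eq) fwd))) ,
      v , inj₁ refl , inj₁ refl

  lineL : Triangle G → Triangle LG
  lineL (tri a b c p q r) = tri (edge a b p) (edge b c q) (edge c a r)
    (meet p q r) (meet q r p) (meet r p q)
    where
    meet : ∀ {a b c} (p : a ~ b) (q : b ~ c) (r : c ~ a) → Adj LG (edge a b p) (edge b c q)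
    meet {a} {b} {c} p q r =
      (λ eq → ~⇒≢ r (sym (joins-unique (joins-resp (edge b c q) (bwd {p = p}) eq) fwd))) ,
      b , inj₂ refl , inj₁ refl

  ≈E-joins : ∀ {a b} p e → _≈E_ G e (edge a b p) → Joins a b e
  ≈E-joins p e eq = joins-resp e (fwd {p = p}) (λ x → proj₂ (eq x) , proj₁ (eq x))

  ∈-clawL⁺ : ∀ {v e} (c : Claw v) i → Joins v (leg c i) e → _∈T_ LG e (clawL c)
  ∈-clawL⁺ c zero             j = inj₁ (joins-≈ j (fwd {p = leg-~ c zero}))
  ∈-clawL⁺ c (suc zero)       j = inj₂ (inj₁ (joins-≈ j (fwd {p = leg-~ c (suc zero)})))
  ∈-clawL⁺ c (suc (suc zero)) j = inj₂ (inj₂ (joins-≈ j (fwd {p = leg-~ c (suc (suc zero))})))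

  ∈-clawL⁻ : ∀ {v} e (c : Claw v) → _∈T_ LG e (clawL c) → ∃ λ i → Joins v (leg c i) e
  ∈-clawL⁻ e c (inj₁ q)        = zero , ≈E-joins (leg-~ c zero) e q
  ∈-clawL⁻ e c (inj₂ (inj₁ q)) = suc zero , ≈E-joins (leg-~ c (suc zero)) e q
  ∈-clawL⁻ e c (inj₂ (inj₂ q)) = suc (suc zero) , ≈E-joins (leg-~ c (suc (suc zero))) e q

  ∈-lineL⁺ : ∀ {a b e} T → Joins a b e → a ∈△ T → b ∈△ T → _∈T_ LG e (lineL T)
  ∈-lineL⁺ T                   j 1st 1st = contradiction refl (~⇒≢ (joins-~ j))
  ∈-lineL⁺ (tri _ _ _ p _ _) j 1st 2nd = inj₁ (joins-≈ j (fwd {p = p}))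
  ∈-lineL⁺ (tri _ _ _ _ _ r) j 1st 3rd = inj₂ (inj₂ (joins-≈ j (bwd {p = r})))
  ∈-lineL⁺ (tri _ _ _ p _ _) j 2nd 1st = inj₁ (joins-≈ j (bwd {p = p}))
  ∈-lineL⁺ T                   j 2nd 2nd = contradiction refl (~⇒≢ (joins-~ j))
  ∈-lineL⁺ (tri _ _ _ _ q _) j 2nd 3rd = inj₂ (inj₁ (joins-≈ j (fwd {p = q})))
  ∈-lineL⁺ (tri _ _ _ _ _ r) j 3rd 1st = inj₂ (inj₂ (joins-≈ j (fwd {p = r})))
  ∈-lineL⁺ (tri _ _ _ _ q _) j 3rd 2nd = inj₂ (inj₁ (joins-≈ j (bwd {p = q})))
  ∈-lineL⁺ T                   j 3rd 3rd = contradiction refl (~⇒≢ (joins-~ j))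

  joins-both : ∀ {a b x y e} {P : Vx → Set} → Joins x y e → P x → P y → Joins a b e → P a × P b
  joins-both fwd px py fwd = px , py
  joins-both fwd px py bwd = py , px
  joins-both bwd px py fwd = py , px
  joins-both bwd px py bwd = px , py

  ∈-lineL⁻ : ∀ {a b e} T → Joins a b e → _∈T_ LG e (lineL T) → a ∈△ T × b ∈△ T
  ∈-lineL⁻ {e = e} T@(tri _ _ _ p _ _) j (inj₁ s) =
    joins-both {P = _∈△ T} (≈E-joins p e s) 1st 2nd j
  ∈-lineL⁻ {e = e} T@(tri _ _ _ _ q _) j (inj₂ (inj₁ s)) =
    joins-both {P = _∈△ T} (≈E-joins q e s) 2nd 3rd j
  ∈-lineL⁻ {e = e} T@(tri _ _ _ _ _ r) j (inj₂ (inj₂ s)) =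
    joins-both {P = _∈△ T} (≈E-joins r e s) 3rd 1st j

  arm : ∀ {v} (c : Claw v) → Fin 3 → Edge G
  arm {v} c i = edge v (leg c i) (leg-~ c i)

  arm∈ : ∀ {v} (c : Claw v) i → _∈T_ LG (arm c i) (clawL c)
  arm∈ c i = ∈-clawL⁺ c i (joins (leg-~ c i))

  -- If `v ≢ w`, every arm of `c` is an arm at `w` and so has `w` as its leg; but the legs of `c`
  -- are distinct.
  clawL≈⇒centre≡ : ∀ {v w} (c : Claw v) (d : Claw w) → clawL c ≈L clawL d → v ≡ w
  clawL≈⇒centre≡ {v} {w} c d eq with v ≟ w
  ... | yes p = p
  ... | no ¬p = contradiction (leg-inj c (trans (leg≡w zero) (sym (leg≡w (suc zero))))) λ ()
    where
    leg≡w : ∀ i → leg c i ≡ w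
    leg≡w i with joins-∈ (proj₂ (∈-clawL⁻ (arm c i) d (proj₁ (eq (arm c i)) (arm∈ c i))))
    ... | inj₁ w≡v = contradiction (sym w≡v) ¬p
    ... | inj₂ w≡leg = sym w≡leg

  clawL≈⇒leg : ∀ {v} (c d : Claw v) → clawL c ≈L clawL d → ∀ i → ∃ λ k → leg c i ≡ leg d k
  clawL≈⇒leg {v} c d eq i with ∈-clawL⁻ (arm c i) d (proj₁ (eq (arm c i)) (arm∈ c i))
  ... | k , j = k , joins-unique (joins (leg-~ c i)) j

  leg⇒clawL≈ : ∀ {v} (c d : Claw v) → (∀ i → ∃ λ k → leg c i ≡ leg d k) →
               (∀ i → ∃ λ k → leg d i ≡ leg c k) → clawL c ≈L clawL d
  leg⇒clawL≈ c d f g e = go c d f , go d c g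
    where
    go : ∀ {v} (c d : Claw v) → (∀ i → ∃ λ k → leg c i ≡ leg d k) →
         _∈T_ LG e (clawL c) → _∈T_ LG e (clawL d)
    go {v} c d f e∈ with i , j ← ∈-clawL⁻ e c e∈ with k , eq ← f i =
      ∈-clawL⁺ d k (subst (λ x → Joins v x e) eq j)

  clawL≉lineL : ∀ {v} (c : Claw v) T → ¬ (clawL c ≈L lineL T)
  clawL≉lineL {v} c T@(tri t₁ t₂ t₃ p q r) eq =
    [ opposite p q r 2nd 3rd , [ opposite q r p 3rd 1st , opposite r p q 1st 2nd ] ]
      (proj₁ (∈-lineL⁻ T (joins (leg-~ c zero)) (proj₁ (eq (arm c zero)) (arm∈ c zero))))
    where
    -- the side opposite to v is not an arm of a claw centred at v
    opposite : ∀ {x y z} → x ~ y → y ~ z → z ~ x → y ∈△ T → z ∈△ T → v ≢ x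
    opposite {y = y} {z} xy yz zx y∈ z∈ refl
      with joins-∈ (proj₂ (∈-clawL⁻ (edge y z yz) c (proj₂ (eq (edge y z yz)) (∈-lineL⁺ T (joins yz) y∈ z∈))))
    ... | inj₁ v≡y = ~⇒≢ xy v≡y
    ... | inj₂ v≡z = ~⇒≢ zx (sym v≡z)

  △-edge : ∀ {v} T → v ∈△ T → ∃ λ w → v ~ w × w ∈△ T
  △-edge (tri _ b _ p _ _) 1st = b , p , 2nd
  △-edge (tri _ _ c _ q _) 2nd = c , q , 3rd
  △-edge (tri a _ _ _ _ r) 3rd = a , r , 1st

  lineL≈⇒⊆ : ∀ S T → lineL S ≈L lineL T → ∀ {v} → v ∈△ S → v ∈△ T
  lineL≈⇒⊆ S T eq {v} v∈ with w , a , w∈ ← △-edge S v∈ =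
    proj₁ (∈-lineL⁻ T (joins a) (proj₁ (eq (edge v w a)) (∈-lineL⁺ S (joins a) v∈ w∈)))

  lineL≈⇒≈△ : ∀ S T → lineL S ≈L lineL T → S ≈△ T
  lineL≈⇒≈△ S T eq v = lineL≈⇒⊆ S T eq , lineL≈⇒⊆ T S (≈L-sym (lineL S) (lineL T) eq)

  ≈△⇒lineL≈ : ∀ S T → S ≈△ T → lineL S ≈L lineL T
  ≈△⇒lineL≈ S T eq e = go S T (λ v → proj₁ (eq v)) , go T S (λ v → proj₂ (eq v))
    where
    go : ∀ S T → (∀ v → v ∈△ S → v ∈△ T) → _∈T_ LG e (lineL S) → _∈T_ LG e (lineL T)
    go S T f e∈ with v∈ , w∈ ← ∈-lineL⁻ S (joins (Edge.adj e)) e∈ =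
      ∈-lineL⁺ T (joins (Edge.adj e)) (f _ v∈) (f _ w∈)

  triL-cong : ∀ {t u} → let open Triangle in
    _≈E_ G (t₁ t) (t₁ u) → _≈E_ G (t₂ t) (t₂ u) → _≈E_ G (t₃ t) (t₃ u) → t ≈L u
  triL-cong {t} {u} p q r e = go (t₁ t) (t₁ u) p ⊎ᶠ (go (t₂ t) (t₂ u) q ⊎ᶠ go (t₃ t) (t₃ u) r)
    where
    open Triangle
    go : ∀ f g → _≈E_ G f g → (_≈E_ G e f → _≈E_ G e g) × (_≈E_ G e g → _≈E_ G e f)
    go f g fg = (λ ef → ≈-equiv LG .IsEquivalence.trans {e} {f} {g} ef fg) ,
                (λ eg → ≈-equiv LG .IsEquivalence.trans {e} {g} {f} eg
                          (≈-equiv LG .IsEquivalence.sym {f} {g} fg))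
    _⊎ᶠ_ : ∀ {A B C D : Set} → (A → B) × (B → A) → (C → D) × (D → C) →
           (A ⊎ C → B ⊎ D) × (B ⊎ D → A ⊎ C)
    (f , f') ⊎ᶠ (g , g') = Sum.map f g , Sum.map f' g'

  claw₃ : ∀ {v x y z} → v ~ x → v ~ y → v ~ z → x ≢ y → x ≢ z → y ≢ z → Claw v
  claw₃ {v} {x} {y} {z} a b c xy xz yz = record
    { leg     = x VF.∷ y VF.∷ z VF.∷ VF.[]
    ; leg-~   = λ { zero → a ; (suc zero) → b ; (suc (suc zero)) → c }
    ; leg-inj = ∷-injective (λ { zero → xy ; (suc zero) → xz })
                  (∷-injective (λ { zero → yz }) (∷-injective (λ ()) []-injective))
    }

  data View (t : Triangle LG) : Set where
    claw : ∀ {v} (c : Claw v) → t ≈L clawL c → View t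
    line : ∀ T → t ≈L lineL T → View t

  -- Let `x`, `y`, `z` be the vertices where the edges meet in turn. If `y` is `x`, all three edges
  -- pass through `x`; otherwise they close up to a triangle of `Γ`.
  view : ∀ t → View t
  view t@(tri e₁ e₂ e₃ (n₁₂ , x , x∈₁ , x∈₂) (n₂₃ , y , y∈₂ , y∈₃) (n₃₁ , z , z∈₃ , z∈₁))
    with p , j₁ ← joins-through e₁ x∈₁ | q , j₂ ← joins-through e₂ x∈₂ = at-y (joins-∈⁻ j₂ y∈₂)
    where
    joins-∈⁻ : ∀ {a b v e} → Joins a b e → _∈E_ G v e → v ≡ a ⊎ v ≡ b
    joins-∈⁻ fwd v∈ = v∈
    joins-∈⁻ bwd v∈ = Sum.swap v∈
    at-y : y ≡ x ⊎ y ≡ q → View t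
    at-y (inj₁ refl) with r , j₃ ← joins-through e₃ y∈₃ =
      claw c (triL-cong {t} {clawL c} (joins-≈ j₁ (joins (joins-~ j₁))) (joins-≈ j₂ (joins (joins-~ j₂)))
        (joins-≈ j₃ (joins (joins-~ j₃))))
      where
      c = claw₃ (joins-~ j₁) (joins-~ j₂) (joins-~ j₃) (λ { refl → n₁₂ (joins-≈ j₁ j₂) })
                (λ { refl → n₃₁ (joins-≈ j₃ j₁) }) (λ { refl → n₂₃ (joins-≈ j₂ j₃) })
    at-y (inj₂ refl) with r , j₃ ← joins-through e₃ y∈₃ = at-z (joins-∈⁻ j₃ z∈₃) (joins-∈⁻ j₁ z∈₁)
      where
      -- The edges now join `x p`, `x q` and `q r`. Three of the four positions of `z` make `e₂` a
      -- loop or two edges equal; only `z = r = p` remains.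
      at-z : z ≡ q ⊎ z ≡ r → z ≡ x ⊎ z ≡ p → View t
      at-z (inj₁ refl) (inj₁ refl) = contradiction refl (~⇒≢ (joins-~ j₂))
      at-z (inj₁ refl) (inj₂ refl) = contradiction (joins-≈ j₁ j₂) n₁₂
      at-z (inj₂ refl) (inj₁ refl) = contradiction (joins-≈ j₂ (joins-sym j₃)) n₂₃
      at-z (inj₂ refl) (inj₂ refl) =
        line T (triL-cong {t} {lineL T} (joins-≈ (joins-sym j₁) (joins (~-sym (joins-~ j₁))))
          (joins-≈ j₂ (joins (joins-~ j₂))) (joins-≈ j₃ (joins (joins-~ j₃))))
        where
        T = tri z x q (~-sym (joins-~ j₁)) (joins-~ j₂) (joins-~ j₃)

-- The degree bound

-- Verified by evaluation over `Fin 4`. It supplies the common legs and common sides in the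
-- configurations on four vertices below.
two-others : ∀ (i j : Fin 4) → ∃₂ λ k l → k ≢ l × (k ≢ i × k ≢ j) × (l ≢ i × l ≢ j)
two-others = from-yes (all? λ (i : Fin 4) → all? λ (j : Fin 4) → any? λ (k : Fin 4) → any? λ (l : Fin 4) →
  ¬? (k ≟ l) ×-dec (¬? (k ≟ i) ×-dec ¬? (k ≟ j)) ×-dec (¬? (l ≟ i) ×-dec ¬? (l ≟ j)))

module Adjacency (Γ : FinGraph) where
  open Geometry Γ public

  infix 4 _~L_
  _~L_ : Triangle LG → Triangle LG → Set
  _~L_ = Adj (C₃ LG)

  ~L-sym : ∀ s t → s ~L t → t ~L s
  ~L-sym s t = Adj-sym (C₃ LG) {s} {t}

  same-centre-~L : ∀ {v} (c d : Claw v) i k → leg c i ≡ leg d k → ¬ (clawL c ≈L clawL d) →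
                   clawL c ~L clawL d
  same-centre-~L {v} c d i k eq ne =
    ne , arm c i , arm∈ c i , ∈-clawL⁺ d k (subst (λ x → Joins v x (arm c i)) eq (joins (leg-~ c i)))

  clawL~clawL : ∀ {v w} (c : Claw v) (d : Claw w) i k → leg c i ≡ w → leg d k ≡ v → clawL c ~L clawL d
  clawL~clawL {v} c d i k refl eq =
    (λ s → ~⇒≢ (leg-~ c i) (clawL≈⇒centre≡ c d s)) , arm c i , arm∈ c i ,
    ∈-clawL⁺ d k (subst (λ x → Joins (leg c i) x (arm c i)) (sym eq) (joins-sym (joins (leg-~ c i))))

  clawL~lineL : ∀ {v} (c : Claw v) T i → v ∈△ T → leg c i ∈△ T → clawL c ~L lineL T
  clawL~lineL c T i v∈ w∈ =
    clawL≉lineL c T , arm c i , arm∈ c i , ∈-lineL⁺ T (joins (leg-~ c i)) v∈ w∈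

  lineL~lineL : ∀ {a b} S T → a ~ b → a ∈△ S → b ∈△ S → a ∈△ T → b ∈△ T → ¬ (S ≈△ T) → lineL S ~L lineL T
  lineL~lineL {a} {b} S T p aS bS aT bT ne =
    (λ s → ne (lineL≈⇒≈△ S T s)) , edge a b p , ∈-lineL⁺ S (joins p) aS bS , ∈-lineL⁺ T (joins p) aT bT

module BoundedDegree (Γ : FinGraph) (φ : C₃ (L (toGraph Γ)) ≅ toGraph Γ) where
  open Adjacency Γ public
  open _≅_ φ public

  to-injective : ∀ s t → to s ≡ to t → s ≈L t
  to-injective s t eq = ≈L-trans s (from (to t)) t
    (≈L-trans s (from (to s)) (from (to t)) (≈L-sym (from (to s)) s (from-to s)) (from-cong eq))
    (from-to t)

  -- Since `to` is injective up to `_≈L_` and keeps adjacency, inequivalent neighbours of `s` become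
  -- distinct neighbours of `to s`. Both growth steps of this module count such a family.
  family⇒≤degree : ∀ {m} s (f : Fin m → Triangle LG) → (∀ {i j} → f i ≈L f j → i ≡ j) →
                   (∀ i → s ~L f i) → m ≤ degree Γ (to s)
  family⇒≤degree s f inj adj = injection⇒≤degree
    (λ {i} {j} eq → inj (to-injective (f i) (f j) eq)) (λ i → adj-to {s} {f i} (adj i))

  -- The first three given neighbours form `base`. Trading one leg of `base` for one of the `k`
  -- others gives `3 * k` further claws at `v`, each sharing two legs with `base`.
  module Exchange {k v} (x : Fin (3 + k) → Vx) (x-inj : Inj x) (x-~ : ∀ i → v ~ x i) where

    base : Claw v
    base = mkClaw (λ i → x (i ↑ˡ k)) (λ i → x-~ (i ↑ˡ k)) (λ eq → ↑ˡ-injective k _ _ (x-inj eq))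

    y : Fin 3 → Vx
    y = leg base

    z : Fin k → Vx
    z j = x (suc (suc (suc j)))

    y≢z : ∀ i j → y i ≢ z j
    y≢z zero             j eq with () ← x-inj eq
    y≢z (suc zero)       j eq with () ← x-inj eq
    y≢z (suc (suc zero)) j eq with () ← x-inj eq

    swapped : Fin 3 → Fin k → Fin 3 → Vx
    swapped i j = VF.updateAt y i (const (z j))

    -- Indexed by the value `a`, so that matching decides whether position `m` carries the new leg
    -- or one kept from `base`, and rewrites `a` accordingly.
    data Leg (i : Fin 3) (j : Fin k) (m : Fin 3) (a : Vx) : Set where
      new : m ≡ i → a ≡ z j → Leg i j m a
      old : m ≢ i → a ≡ y m → Leg i j m a

    leg-view : ∀ i j m → Leg i j m (swapped i j m)
    leg-view i j m with m ≟ i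
    ... | yes refl = new refl (updateAt-updates i y)
    ... | no m≢i   = old m≢i (updateAt-minimal m i y m≢i)

    exchange : Fin 3 → Fin k → Claw v
    exchange i j = mkClaw (swapped i j) (λ m → ~s (leg-view i j m))
                          (λ {m} {m'} → inj (leg-view i j m) (leg-view i j m'))
      where
      ~s : ∀ {m a} → Leg i j m a → v ~ a
      ~s (new _ refl) = x-~ _
      ~s (old _ refl) = leg-~ base _
      inj : ∀ {m m' a a'} → Leg i j m a → Leg i j m' a' → a ≡ a' → m ≡ m'
      inj (new p _) (new q _) eq = trans p (sym q)
      inj (new _ refl) (old _ refl) eq = contradiction (sym eq) (y≢z _ _)
      inj (old _ refl) (new _ refl) eq = contradiction eq (y≢z _ _)
      inj (old _ refl) (old _ refl) eq = leg-inj base eq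

    z-leg : ∀ {i j m a j'} → Leg i j m a → z j' ≡ a → j' ≡ j
    z-leg (new _ refl) eq = suc-injective (suc-injective (suc-injective (x-inj eq)))
    z-leg (old _ refl) eq = contradiction (sym eq) (y≢z _ _)

    y-leg : ∀ {i j m a} → Leg i j m a → y i ≢ a
    y-leg (new _ refl)   eq = y≢z _ _ eq
    y-leg (old m≢i refl) eq = m≢i (sym (leg-inj base eq))

    z-occurs : ∀ i j → swapped i j i ≡ z j
    z-occurs i j = updateAt-updates i y

    -- The missing leg `y i` determines `i`, since it survives in `exchange i' j'` when `i ≢ i'`;
    -- the new leg determines `j`.
    exchange-injective : ∀ i j i' j' → clawL (exchange i j) ≈L clawL (exchange i' j') → i ≡ i' × j ≡ j'
    exchange-injective i j i' j' eq with i ≟ i'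
    ... | yes i≡i' = i≡i' , j≡j'
      where
      j≡j' : j ≡ j'
      j≡j' with m , p ← clawL≈⇒leg (exchange i j) (exchange i' j') eq i =
        z-leg (leg-view i' j' m) (trans (sym (z-occurs i j)) p)
    ... | no i≢i' with m , p ← clawL≈⇒leg (exchange i' j') (exchange i j)
                        (≈L-sym (clawL (exchange i j)) (clawL (exchange i' j')) eq) i =
        contradiction (trans (sym (updateAt-minimal i i' y i≢i')) p) (y-leg (leg-view i j m))

    base≉exchange : ∀ i j → ¬ (clawL base ≈L clawL (exchange i j))
    base≉exchange i j eq with m , p ← clawL≈⇒leg base (exchange i j) eq i = y-leg (leg-view i j m) p

    base~exchange : ∀ i j → clawL base ~L clawL (exchange i j)
    base~exchange i j = same-centre-~L base (exchange i j) m m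
      (sym (updateAt-minimal m i y (punchInᵢ≢i i zero))) (base≉exchange i j)
      -- A position other than `i`, where both claws have the same leg.
      where m = punchIn i zero

    3k≤degree : 3 * k ≤ degree Γ (to (clawL base))
    3k≤degree = family⇒≤degree (clawL base) (λ p → clawL (uncurry exchange (remQuot {3} k p)))
      (λ {p} {q} eq → remQuot-injective p q
        (exchange-injective (proj₁ (remQuot {3} k p)) _ (proj₁ (remQuot {3} k q)) _ eq))
      (λ p → uncurry base~exchange (remQuot {3} k p))
      where
      remQuot-injective : ∀ p q → proj₁ (remQuot {3} k p) ≡ proj₁ (remQuot {3} k q) ×
                                  proj₂ (remQuot {3} k p) ≡ proj₂ (remQuot {3} k q) → p ≡ q
      remQuot-injective p q (i≡ , j≡) =
        trans (sym (combine-remQuot {3} k p)) (trans (cong₂ combine i≡ j≡) (combine-remQuot {3} k q))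

  -- Of the `5 + k` neighbours, `2 + k` lie outside `base`, and `3 * (2 + k)` is at least `6 + k`.
  degree-climbs : ∀ {k v} → 5 + k ≤ degree Γ v → ∃ λ w → 6 + k ≤ degree Γ w
  degree-climbs {k} 5+k≤ with x , inj , adj ← ≤degree⇒injection 5+k≤ =
    to (clawL base) , ≤-trans (≤-trans (m≤m+n (6 + k) (k + k)) (≤-reflexive (lem k))) 3k≤degree
    where
    open Exchange {2 + k} x inj adj
    lem : ∀ k → 6 + k + (k + k) ≡ 3 * (2 + k)
    lem = solve-∀

  -- `punchIn i` lists the indices other than `i`. They give both the triangle `face i` opposite
  -- `w i` and the legs of the claw `corner i`.
  module K₄ (w : Fin 4 → Vx) (w-~ : ∀ {i j} → i ≢ j → w i ~ w j) where

    w-inj : Inj w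
    w-inj {i} {j} eq with i ≟ j
    ... | yes i≡j = i≡j
    ... | no i≢j  = contradiction eq (~⇒≢ (w-~ i≢j))

    face : Fin 4 → Triangle G
    face i = tri (w (punchIn i zero)) (w (punchIn i (suc zero))) (w (punchIn i (suc (suc zero))))
                 (side (λ ())) (side (λ ())) (side (λ ()))
      where
      side : ∀ {a b} → a ≢ b → w (punchIn i a) ~ w (punchIn i b)
      side a≢b = w-~ (a≢b ∘ punchIn-injective i _ _)

    corner : ∀ i → Claw (w i)
    corner i = mkClaw (w ∘ punchIn i) (λ a → w-~ (punchInᵢ≢i i a ∘ sym)) (punchIn-injective i _ _ ∘ w-inj)

    ∈-face⁺ : ∀ {i k} → k ≢ i → w k ∈△ face i
    ∈-face⁺ {i} {k} k≢i = subst (λ m → w m ∈△ face i) (punchIn-punchOut (k≢i ∘ sym))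
      (go (punchOut (k≢i ∘ sym)))
      where
      go : ∀ a → w (punchIn i a) ∈△ face i
      go zero             = 1st
      go (suc zero)       = 2nd
      go (suc (suc zero)) = 3rd

    ∉-face : ∀ i → ¬ (w i ∈△ face i)
    ∉-face i (inj₁ eq)        = punchInᵢ≢i i _ (w-inj (sym eq))
    ∉-face i (inj₂ (inj₁ eq)) = punchInᵢ≢i i _ (w-inj (sym eq))
    ∉-face i (inj₂ (inj₂ eq)) = punchInᵢ≢i i _ (w-inj (sym eq))

    face-injective : ∀ {i j} → face i ≈△ face j → i ≡ j
    face-injective {i} {j} eq with i ≟ j
    ... | yes i≡j = i≡j
    ... | no i≢j  = contradiction (proj₂ (eq (w i)) (∈-face⁺ i≢j)) (∉-face i)

    -- The two faces share the side joining the two remaining vertices.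
    face~face : ∀ i j → i ≢ j → lineL (face i) ~L lineL (face j)
    face~face i j i≢j with k , l , k≢l , (k≢i , k≢j) , (l≢i , l≢j) ← two-others i j =
      lineL~lineL (face i) (face j) (w-~ k≢l) (∈-face⁺ k≢i) (∈-face⁺ l≢i) (∈-face⁺ k≢j) (∈-face⁺ l≢j)
        (i≢j ∘ face-injective)

    -- The edge from `w i` to a third vertex `w k` is an arm at `w i` and also a side of the face
    -- avoiding `w j`.
    corner~face : ∀ i j → i ≢ j → clawL (corner i) ~L lineL (face j)
    corner~face i j i≢j with k , _ , _ , (k≢i , k≢j) , _ ← two-others i j =
      clawL~lineL (corner i) (face j) (punchOut (k≢i ∘ sym)) (∈-face⁺ i≢j)
        (subst (λ m → w m ∈△ face j) (sym (punchIn-punchOut (k≢i ∘ sym))) (∈-face⁺ k≢j))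

    -- Six neighbours of `lineL (face zero)`: the three other faces, and the claws at the three
    -- vertices of `face zero`.
    neighbour : Fin 3 ⊎ Fin 3 → Triangle LG
    neighbour = [ lineL ∘ face ∘ suc , (λ i → clawL (corner (suc i))) ]

    neighbour-injective : ∀ a b → neighbour a ≈L neighbour b → a ≡ b
    neighbour-injective (inj₁ i) (inj₁ j) eq =
      cong inj₁ (suc-injective (face-injective (lineL≈⇒≈△ (face (suc i)) (face (suc j)) eq)))
    neighbour-injective (inj₁ i) (inj₂ j) eq =
      contradiction (≈L-sym (lineL (face (suc i))) (clawL (corner (suc j))) eq)
        (clawL≉lineL (corner (suc j)) (face (suc i)))
    neighbour-injective (inj₂ i) (inj₁ j) eq =
      contradiction eq (clawL≉lineL (corner (suc i)) (face (suc j)))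
    neighbour-injective (inj₂ i) (inj₂ j) eq =
      cong inj₂ (suc-injective (w-inj (clawL≈⇒centre≡ (corner (suc i)) (corner (suc j)) eq)))

    6≤degree : 6 ≤ degree Γ (to (lineL (face zero)))
    6≤degree = family⇒≤degree (lineL (face zero)) (neighbour ∘ splitAt 3)
      (λ {p} {q} eq → trans (sym (join-splitAt 3 3 p))
        (trans (cong (join 3 3) (neighbour-injective (splitAt 3 p) (splitAt 3 q) eq)) (join-splitAt 3 3 q)))
      (λ p → adj (splitAt 3 p))
      where
      adj : ∀ a → lineL (face zero) ~L neighbour a
      adj (inj₁ i) = face~face zero (suc i) λ ()
      adj (inj₂ i) = ~L-sym (clawL (corner (suc i))) (lineL (face zero)) (corner~face (suc i) zero λ ())

  -- Fix four neighbours of `v`. Any two of the four claws omitting one of them have a common leg,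
  -- hence are adjacent, and `to` carries the four claws to a complete graph on four vertices of
  -- `Γ`.
  4≤degree⇒6≤degree : ∀ {v} → 4 ≤ degree Γ v → ∃ λ w → 6 ≤ degree Γ w
  4≤degree⇒6≤degree {v} 4≤ with x , inj , adj ← ≤degree⇒injection 4≤ =
    _ , K₄.6≤degree (λ i → to (clawL (omit i)))
          (λ {i} {j} i≢j → adj-to {clawL (omit i)} {clawL (omit j)} (omit~omit i≢j))
    where
    omit : Fin 4 → Claw v
    omit i = mkClaw (x ∘ punchIn i) (adj ∘ punchIn i) (punchIn-injective i _ _ ∘ inj)
    at : ∀ {i k} (k≢i : k ≢ i) → leg (omit i) (punchOut (k≢i ∘ sym)) ≡ x k
    at k≢i = cong x (punchIn-punchOut (k≢i ∘ sym))
    omit≉omit : ∀ {i j} → i ≢ j → ¬ (clawL (omit i) ≈L clawL (omit j))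
    omit≉omit {i} {j} i≢j eq
      with m , p ← clawL≈⇒leg (omit i) (omit j) eq (punchOut i≢j) =
      punchInᵢ≢i j m (inj (trans (sym p) (cong x (punchIn-punchOut i≢j))))
    omit~omit : ∀ {i j} → i ≢ j → clawL (omit i) ~L clawL (omit j)
    omit~omit {i} {j} i≢j with k , _ , _ , (k≢i , k≢j) , _ ← two-others i j =
      same-centre-~L (omit i) (omit j) _ _ (trans (at k≢i) (sym (at k≢j))) (omit≉omit i≢j)

  degree≤3 : ∀ v → degree Γ v ≤ 3
  -- Some degree would be at least `5 + n Γ`, more than there are vertices.
  degree≤3 v = ≮⇒≥ λ 4≤ → let w , 5+n≤ = climb (4≤degree⇒6≤degree 4≤) (n Γ) in
    <⇒≱ (≤-trans (m≤n+m (suc (n Γ)) 4) 5+n≤) (degree≤n w)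
    where
    climb : (∃ λ w → 6 ≤ degree Γ w) → ∀ k → ∃ λ w → 5 + k ≤ degree Γ w
    -- The bound 6 is weakened to 5, where `degree-climbs` starts.
    climb (w , 6≤) zero    = w , ≤-trans (m≤n+m 5 1) 6≤
    climb top      (suc k) = let _ , 5+k≤ = climb top k in degree-climbs 5+k≤

-- Triangles of the line graph in maximum degree 3

module Subcubic (Γ : FinGraph) (degree≤3 : ∀ v → degree Γ v ≤ 3) where
  open Adjacency Γ

  claw⇒degree≡3 : ∀ {v} → Claw v → degree Γ v ≡ 3
  claw⇒degree≡3 {v} c = ≤-antisym (degree≤3 v) (injection⇒≤degree (leg-inj c) (leg-~ c))

  degree≡3⇒claw : ∀ {v} → degree Γ v ≡ 3 → Claw v
  degree≡3⇒claw eq with x , inj , adj ← ≤degree⇒injection (≤-reflexive (sym eq)) = mkClaw x adj inj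

  claw-exhausts : ∀ {v w} (c : Claw v) → v ~ w → ∃ λ i → w ≡ leg c i
  claw-exhausts {v} c = nbrs-exhausted (leg-inj c) (leg-~ c) (degree≤3 v)

  -- With at most three neighbours at `v`, the legs of every claw at `v` are all of them.
  clawL-unique : ∀ {v} (c d : Claw v) → clawL c ≈L clawL d
  clawL-unique c d = leg⇒clawL≈ c d (λ i → claw-exhausts d (leg-~ c i)) (λ i → claw-exhausts c (leg-~ d i))

  clawL~clawL⁺ : ∀ {v w} (c : Claw v) (d : Claw w) → v ~ w → clawL c ~L clawL d
  clawL~clawL⁺ c d v~w with i , p ← claw-exhausts c v~w | k , q ← claw-exhausts d (~-sym v~w) =
    clawL~clawL c d i k (sym p) (sym q)

  -- The common edge contains both centres. These differ, because claws with the same centre are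
  -- equivalent, so the edge joins them.
  clawL~clawL⁻ : ∀ {v w} (c : Claw v) (d : Claw w) → clawL c ~L clawL d → v ~ w
  clawL~clawL⁻ {v} {w} c d (ne , e , e∈c , e∈d)
    with i , j ← ∈-clawL⁻ e c e∈c | k , j' ← ∈-clawL⁻ e d e∈d = go j j'
    where
    v≢w : v ≢ w
    v≢w refl = ne (clawL-unique c d)
    go : ∀ {x y e} → Joins v x e → Joins w y e → v ~ w
    go fwd fwd = contradiction refl v≢w
    go (fwd {p}) bwd = p
    go (bwd {p}) fwd = ~-sym p
    go bwd bwd = contradiction refl v≢w

  clawL~lineL⁺ : ∀ {v} (c : Claw v) T → v ∈△ T → clawL c ~L lineL T
  clawL~lineL⁺ c T v∈ with w , v~w , w∈ ← △-edge T v∈ with i , p ← claw-exhausts c v~w =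
    clawL~lineL c T i v∈ (subst (_∈△ T) p w∈)

  clawL~lineL⁻ : ∀ {v} (c : Claw v) T → clawL c ~L lineL T → v ∈△ T
  clawL~lineL⁻ c T (_ , e , e∈c , e∈T) with i , j ← ∈-clawL⁻ e c e∈c = proj₁ (∈-lineL⁻ T j e∈T)

  -- A triangle seen from one of its vertices, which spares later arguments the split on which
  -- vertex that is.
  record Apex (v : Vx) (T : Triangle G) : Set where
    field
      {left right} : Vx
      v~left       : v ~ left
      v~right      : v ~ right
      left≢right   : left ≢ right
      left∈        : left ∈△ T
      right∈       : right ∈△ T
      cover        : ∀ {w} → w ∈△ T → w ≡ v ⊎ w ≡ left ⊎ w ≡ right

  apex : ∀ {v} T → v ∈△ T → Apex v T
  apex (tri a b c p q r) 1st = record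
    { v~left = p ; v~right = ~-sym r ; left≢right = ~⇒≢ q ; left∈ = 2nd ; right∈ = 3rd ; cover = λ w∈ → w∈ }
  apex (tri a b c p q r) 2nd = record
    { v~left = q ; v~right = ~-sym p ; left≢right = ~⇒≢ r ; left∈ = 3rd ; right∈ = 1st
    ; cover = λ { 1st → 3rd ; 2nd → 1st ; 3rd → 2nd } }
  apex (tri a b c p q r) 3rd = record
    { v~left = r ; v~right = ~-sym q ; left≢right = ~⇒≢ p ; left∈ = 1st ; right∈ = 2nd
    ; cover = λ { 1st → 2nd ; 2nd → 3rd ; 3rd → 1st } }

  -- The two other vertices of `T` already account for all neighbours of `v`.
  degree≤2⇒nbr∈△ : ∀ {v w} T → degree Γ v ≤ 2 → v ∈△ T → v ~ w → w ∈△ T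
  degree≤2⇒nbr∈△ {v} {w} T d≤2 v∈ v~w = go (nbrs-exhausted g-inj g-~ d≤2 v~w)
    where
    open Apex (apex T v∈)
    g : Fin 2 → Vx
    g = left VF.∷ right VF.∷ VF.[]
    g-inj : Inj g
    g-inj = ∷-injective (λ { zero → left≢right }) (∷-injective (λ ()) []-injective)
    g-~ : ∀ i → v ~ g i
    g-~ zero       = v~left
    g-~ (suc zero) = v~right
    go : (∃ λ i → w ≡ g i) → w ∈△ T
    go (zero     , refl) = left∈
    go (suc zero , refl) = right∈

  △-clique : ∀ {v w} T → v ∈△ T → w ∈△ T → v ≢ w → v ~ w
  △-clique {v} {w} T v∈ w∈ v≢w with Apex.cover (apex T v∈) w∈
  ... | 1st = contradiction refl v≢w
  ... | 2nd = Apex.v~left (apex T v∈)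
  ... | 3rd = Apex.v~right (apex T v∈)

  degree≤2⇒△-unique : ∀ {v} S T → degree Γ v ≤ 2 → v ∈△ S → v ∈△ T → S ≈△ T
  degree≤2⇒△-unique {v} S T d≤2 v∈S v∈T w = ⊆ S T v∈S v∈T , ⊆ T S v∈T v∈S
    where
    ⊆ : ∀ S T → v ∈△ S → v ∈△ T → w ∈△ S → w ∈△ T
    ⊆ S T v∈S v∈T w∈S with v ≟ w
    ... | yes refl = v∈T
    ... | no v≢w   = degree≤2⇒nbr∈△ T d≤2 v∈T (△-clique S v∈S w∈S v≢w)

  -- Two triangles at v use two each of the at most three edges at v.
  meeting⇒lineL~lineL : ∀ {v} S T → v ∈△ S → v ∈△ T → ¬ (S ≈△ T) → lineL S ~L lineL T
  meeting⇒lineL~lineL {v} S T v∈S v∈T ne with common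
    where
    open Apex (apex S v∈S) renaming (left to a; right to b)
    open Apex (apex T v∈T) renaming (left to a'; right to b'; v~left to v~a'; v~right to v~b';
      left≢right to a'≢b'; left∈ to a'∈; right∈ to b'∈; cover to cover')
    common : ∃ λ w → v ~ w × w ∈△ S × w ∈△ T
    common with a ≟ a' | b ≟ a'
    ... | yes p   | _       = a , v~left , left∈ , subst (_∈△ T) (sym p) a'∈
    ... | _       | yes p   = b , v~right , right∈ , subst (_∈△ T) (sym p) a'∈
    ... | no a≢a' | no b≢a' with claw-exhausts (claw₃ v~left v~right v~a' left≢right a≢a' b≢a') v~b'
    ...   | zero           , p = a , v~left , left∈ , subst (_∈△ T) p b'∈
    ...   | suc zero       , p = b , v~right , right∈ , subst (_∈△ T) p b'∈
    ...   | suc (suc zero) , p = contradiction (sym p) a'≢b'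
  ... | w , v~w , w∈S , w∈T = lineL~lineL S T v~w v∈S w∈S v∈T w∈T ne

-- Sums over Fin N and the double count

# : {P : Set} → Dec P → ℕ
# d = if does d then 1 else 0

#-yes : ∀ {P : Set} (d : Dec P) → P → # d ≡ 1
#-yes (yes _) _ = refl
#-yes (no ¬p) p = contradiction p ¬p

#-no : ∀ {P : Set} (d : Dec P) → ¬ P → # d ≡ 0
#-no (yes p) ¬p = contradiction p ¬p
#-no (no _)  _  = refl

#-cong : ∀ {P Q : Set} (d : Dec P) (e : Dec Q) → (P → Q) → (Q → P) → # d ≡ # e
#-cong (yes p) e f g = sym (#-yes e (f p))
#-cong (no ¬p) e f g = sym (#-no e (¬p ∘ g))

#≢0 : ∀ {P : Set} (d : Dec P) → # d ≢ 0 → P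
#≢0 (yes p) _  = p
#≢0 (no _)  ne = contradiction refl ne

#≤1 : ∀ {P : Set} (d : Dec P) → # d ≤ 1
#≤1 (yes _) = ≤-refl
#≤1 (no _)  = z≤n

sum-tabulate : ∀ {N} (f : Fin N → ℕ) → ListAction.sum (tabulate f) ≡ sum f
sum-tabulate {zero}  f = refl
sum-tabulate {suc N} f = cong (f zero +_) (sum-tabulate (f ∘ suc))

sum-allFin : ∀ {N} (f : Fin N → ℕ) → ListAction.sum (List.map f (allFin N)) ≡ sum f
sum-allFin f = trans (cong ListAction.sum (map-tabulate (λ i → i) f)) (sum-tabulate f)

∑-mono : ∀ {N} {f g : Fin N → ℕ} → (∀ i → f i ≤ g i) → sum f ≤ sum g
∑-mono {zero}  f≤g = z≤n
∑-mono {suc N} f≤g = +-mono-≤ (f≤g zero) (∑-mono (f≤g ∘ suc))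

-- Equal totals leave no slack in any term. This is what extracts the equality case of the double
-- count.
∑-tight : ∀ {N} {f g : Fin N → ℕ} → (∀ i → f i ≤ g i) → sum f ≡ sum g → ∀ i → f i ≡ g i
∑-tight {suc N} {f} {g} f≤g eq zero = ≤-antisym (f≤g zero)
  (+-cancelʳ-≤ (sum (f ∘ suc)) _ _ (≤-trans (+-monoʳ-≤ (g zero) (∑-mono (f≤g ∘ suc))) (≤-reflexive (sym eq))))
∑-tight {suc N} {f} {g} f≤g eq (suc i) = ∑-tight (f≤g ∘ suc)
  (+-cancelˡ-≡ (g zero) _ _ (trans (cong (_+ _) (sym (∑-tight f≤g eq zero))) eq)) i

∑-zero : ∀ {N} {f : Fin N → ℕ} → (∀ i → f i ≡ 0) → sum f ≡ 0
∑-zero {zero}  f≡0 = refl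
∑-zero {suc N} f≡0 = cong₂ _+_ (f≡0 zero) (∑-zero (f≡0 ∘ suc))

∑≡0 : ∀ {N} {f : Fin N → ℕ} → sum f ≡ 0 → ∀ i → f i ≡ 0
∑≡0 {f = f} eq zero    = m+n≡0⇒m≡0 (f zero) eq
∑≡0 {f = f} eq (suc i) = ∑≡0 (m+n≡0⇒n≡0 (f zero) eq) i

∑≢0 : ∀ {N} (f : Fin N → ℕ) → sum f ≢ 0 → ∃ λ i → f i ≢ 0
∑≢0 {zero}  f ne = contradiction refl ne
∑≢0 {suc N} f ne with f zero in eq
... | zero  = let i , fi = ∑≢0 (f ∘ suc) ne in suc i , fi
... | suc m = zero , λ z → contradiction (trans (sym eq) z) λ ()

*-≢0 : ∀ m {k} → m * k ≢ 0 → m ≢ 0 × k ≢ 0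
*-≢0 m ne = (λ { refl → ne refl }) , (λ { refl → ne (*-zeroʳ m) })

term≤∑ : ∀ {N} (f : Fin N → ℕ) i → f i ≤ sum f
term≤∑ f zero    = m≤m+n _ _
term≤∑ f (suc i) = ≤-trans (term≤∑ (f ∘ suc) i) (m≤n+m _ (f zero))

∑≤1 : ∀ {N} (f : Fin N → ℕ) → (∀ i → f i ≤ 1) → (∀ {i j} → f i ≢ 0 → f j ≢ 0 → i ≡ j) → sum f ≤ 1
∑≤1 {zero}  f f≤1 uniq = z≤n
∑≤1 {suc N} f f≤1 uniq with f zero in eq
... | zero  = ∑≤1 (f ∘ suc) (f≤1 ∘ suc) (λ p q → suc-injective (uniq p q))
... | suc m = ≤-trans (≤-reflexive (trans (cong₂ _+_ (sym eq) (∑-zero rest)) (+-identityʳ (f zero)))) (f≤1 zero)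
  where
  rest : ∀ i → f (suc i) ≡ 0
  rest i with f (suc i) in eq'
  ... | zero  = refl
  ... | suc _ with () ← uniq {zero} {suc i} (λ z → contradiction (trans (sym eq) z) λ ())
                          (λ z → contradiction (trans (sym eq') z) λ ())

∑≡1 : ∀ {N} (f : Fin N → ℕ) → (∀ i → f i ≤ 1) → (∀ {i j} → f i ≢ 0 → f j ≢ 0 → i ≡ j) →
      ∀ i → f i ≡ 1 → sum f ≡ 1
∑≡1 f f≤1 uniq i eq = ≤-antisym (∑≤1 f f≤1 uniq) (≤-trans (≤-reflexive (sym eq)) (term≤∑ f i))

∑-δ : ∀ {N} (x : Fin N → ℕ) t → sum (λ u → x u * # (u ≟ t)) ≡ x t
∑-δ x zero    = trans (cong₂ _+_ (*-identityʳ (x zero)) (∑-zero (λ i → *-zeroʳ (x (suc i))))) (+-identityʳ _)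
∑-δ x (suc t) = cong₂ _+_ (*-zeroʳ (x zero)) (∑-δ (x ∘ suc) t)

∑-*-comm : ∀ {M N} (x : Fin M → ℕ) (y : Fin N → ℕ) (f : Fin M → Fin N → ℕ) →
           sum (λ i → x i * sum (λ u → y u * f i u)) ≡ sum (λ u → y u * sum (λ i → x i * f i u))
∑-*-comm x y f = begin
  sum (λ i → x i * sum (λ u → y u * f i u))   ≡⟨ sum-cong-≗ (λ i → *-distribˡ-sum (x i) (λ u → y u * f i u)) ⟩
  sum (λ i → sum (λ u → x i * (y u * f i u))) ≡⟨ ∑-comm (λ i u → x i * (y u * f i u)) ⟩
  sum (λ u → sum (λ i → x i * (y u * f i u))) ≡⟨ sum-cong-≗ (λ u → sum-cong-≗ (λ i → lem (x i) (y u) (f i u))) ⟩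
  sum (λ u → sum (λ i → y u * (x i * f i u))) ≡⟨ sum-cong-≗ (λ u → *-distribˡ-sum (y u) (λ i → x i * f i u)) ⟨
  sum (λ u → y u * sum (λ i → x i * f i u))   ∎
  where
  open ≡-Reasoning
  lem : ∀ a b c → a * (b * c) ≡ b * (a * c)
  lem = solve-∀

on-support : ∀ m {a b} → (m ≢ 0 → a ≡ b) → m * a ≡ m * b
on-support zero    e = refl
on-support (suc m) e = cong (suc m *_) (e λ ())

-- M is the graph of a bijection between the supports of x and y.
∑-reindex : ∀ {N} (M : Fin N → Fin N → ℕ) {x y f g : Fin N → ℕ} →
            (∀ i → sum (M i) ≡ x i) → (∀ u → sum (λ i → M i u) ≡ y u) →
            (∀ i u → M i u ≢ 0 → f i ≡ g u) →
            sum (λ i → x i * f i) ≡ sum (λ u → y u * g u)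
∑-reindex M {x} {y} {f} {g} rows cols fg = begin
  sum (λ i → x i * f i)
    ≡⟨ sum-cong-≗ (λ i → trans (cong (_* f i) (sym (rows i))) (*-distribʳ-sum (f i) (M i))) ⟩
  sum (λ i → sum (λ u → M i u * f i)) ≡⟨ sum-cong-≗ (λ i → sum-cong-≗ (λ u → on-support (M i u) (fg i u))) ⟩
  sum (λ i → sum (λ u → M i u * g u)) ≡⟨ ∑-comm (λ i u → M i u * g u) ⟩
  sum (λ u → sum (λ i → M i u * g u))
    ≡⟨ sum-cong-≗ (λ u → trans (sym (*-distribʳ-sum (g u) (λ i → M i u))) (cong (_* g u) (cols u))) ⟩
  sum (λ u → y u * g u) ∎
  where
  open ≡-Reasoning

on-support-≤ : ∀ m {a b} → (m ≢ 0 → a ≤ b) → m * a ≤ m * b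
on-support-≤ zero    e = z≤n
on-support-≤ (suc m) e = *-monoʳ-≤ (suc m) (e λ ())

on-support⁻ : ∀ m {a b} → m ≢ 0 → m * a ≡ m * b → a ≡ b
on-support⁻ zero    m≢0 e = contradiction refl m≢0
on-support⁻ (suc m) m≢0 e = *-cancelˡ-≡ _ _ (suc m) e

-- A double count in a graph with adjacency matrix a.  The vertices are split twice, by the
-- indicators p + q and l + h; M matches the q-vertices with the h-vertices, and R relates each
-- p-vertex to three vertices.  In the application p and q mark the images of triangles and of
-- claws, l and h the vertices of degree at most 2 and of degree 3, and R is incidence.
record CountingData (N : ℕ) : Set where
  field
    a M R     : Fin N → Fin N → ℕ
    p q l h   : Fin N → ℕ
    a-sym     : ∀ i j → a i j ≡ a j i
    p+q≡1     : ∀ i → p i + q i ≡ 1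
    l+h≡1     : ∀ u → l u + h u ≡ 1
    M-rows    : ∀ i → sum (M i) ≡ q i
    M-cols    : ∀ u → sum (λ i → M i u) ≡ h u
    M-a       : ∀ i u → M i u ≢ 0 → ∀ j v → M j v ≢ 0 → a i j ≡ a u v
    R-rows    : ∀ i → p i ≢ 0 → sum (R i) ≡ 3
    M-R       : ∀ i → p i ≢ 0 → ∀ j u → M j u ≢ 0 → a i j ≡ R i u
    R-cols≤1  : ∀ u → l u ≢ 0 → sum (λ i → p i * R i u) ≤ 1
    a-rows≤2  : ∀ u → l u ≢ 0 → sum (a u) ≤ 2

module Count {N} (D : CountingData N) where
  open CountingData D

  -- In the application this counts ordered adjacent pairs: `W p p` is `2 e(P)`, while `W p q` is
  -- `e(P,Q)`.
  W : (Fin N → ℕ) → (Fin N → ℕ) → ℕ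
  W x y = sum λ i → x i * sum (λ j → y j * a i j)

  ∑-split : ∀ (x y : Fin N → ℕ) (f : Fin N → ℕ) → (∀ i → x i + y i ≡ 1) →
            sum f ≡ sum (λ i → x i * f i) + sum (λ i → y i * f i)
  ∑-split x y f e = trans
    (sum-cong-≗ (λ i → trans (sym (*-identityˡ (f i)))
      (trans (cong (_* f i) (sym (e i))) (*-distribʳ-+ (f i) (x i) (y i)))))
    (∑-distrib-+ (λ i → x i * f i) (λ i → y i * f i))

  W-sym : ∀ x y → W x y ≡ W y x
  W-sym x y = trans (∑-*-comm x y a)
    (sum-cong-≗ (λ u → cong (y u *_) (sum-cong-≗ (λ i → cong (x i *_) (a-sym i u)))))

  W-split : ∀ (x y z : Fin N → ℕ) → (∀ i → x i + y i ≡ 1) →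
            sum (λ i → z i * sum (a i)) ≡ W z x + W z y
  W-split x y z e = trans
    (sum-cong-≗ (λ i → trans (cong (z i *_) (∑-split x y (a i) e)) (*-distribˡ-+ (z i) _ _)))
    (∑-distrib-+ (λ i → z i * sum (λ j → x j * a i j)) (λ i → z i * sum (λ j → y j * a i j)))

  total-split : ∀ (x y : Fin N → ℕ) → (∀ i → x i + y i ≡ 1) →
                sum (λ i → sum (a i)) ≡ W x x + 2 * W x y + W y y
  total-split x y e = begin
    sum (λ i → sum (a i))           ≡⟨ ∑-split x y (λ i → sum (a i)) e ⟩
    sum (λ i → x i * sum (a i)) + sum (λ i → y i * sum (a i))
                                    ≡⟨ cong₂ _+_ (W-split x y x e) (W-split x y y e) ⟩
    W x x + W x y + (W y x + W y y) ≡⟨ cong (λ w → W x x + W x y + (w + W y y)) (W-sym y x) ⟩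
    W x x + W x y + (W x y + W y y) ≡⟨ lem (W x x) (W x y) (W y y) ⟩
    W x x + 2 * W x y + W y y       ∎
    where
    open ≡-Reasoning
    lem : ∀ a b c → a + b + (b + c) ≡ a + 2 * b + c
    lem = solve-∀

  -- By `M-a` the matching carries `a` on the `q`-vertices to `a` on the `h`-vertices, so both sums
  -- can be reindexed along it.
  QQ≡HH : W q q ≡ W h h
  QQ≡HH = ∑-reindex M M-rows M-cols λ i u m → ∑-reindex M M-rows M-cols λ j v m' → M-a i u m j v m'

  ∑p≡∑l : sum p ≡ sum l
  ∑p≡∑l = +-cancelʳ-≡ (sum h) _ _ (begin
    sum p + sum h ≡⟨ cong (sum p +_) (sym ∑q≡∑h) ⟩
    sum p + sum q ≡⟨ ∑-distrib-+ p q ⟨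
    sum (λ i → p i + q i) ≡⟨ sum-cong-≗ (λ i → trans (p+q≡1 i) (sym (l+h≡1 i))) ⟩
    sum (λ i → l i + h i) ≡⟨ ∑-distrib-+ l h ⟩
    sum l + sum h ∎)
    where
    open ≡-Reasoning
    ∑q≡∑h : sum q ≡ sum h
    ∑q≡∑h = trans (sum-cong-≗ (sym ∘ *-identityʳ ∘ q))
      (trans (∑-reindex M {q} {h} M-rows M-cols (λ _ _ _ → refl)) (sum-cong-≗ (*-identityʳ ∘ h)))

  -- The sum of `r(u)` over `u ∈ L`, counted by triangles; `RL′` counts it by vertices.
  RL : ℕ
  RL = sum λ i → p i * sum (λ u → l u * R i u)

  RL′ : RL ≡ sum (λ u → l u * sum (λ i → p i * R i u))
  RL′ = ∑-*-comm p l R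

  -- Each triangle has three corners. `RL` counts those in `l`; those in `h` correspond under the
  -- matching to the claws adjacent to the triangle, by `M-R`.
  PQ+RL : RL + W p q ≡ sum p * 3
  PQ+RL = begin
    RL + W p q ≡⟨ cong (RL +_) (sum-cong-≗ λ i → on-support (p i) λ pi →
                    ∑-reindex M M-rows M-cols (M-R i pi)) ⟩
    RL + sum (λ i → p i * sum (λ u → h u * R i u)) ≡⟨ ∑-distrib-+ (λ i → p i * sum (λ u → l u * R i u)) _ ⟨
    sum (λ i → p i * sum (λ u → l u * R i u) + p i * sum (λ u → h u * R i u))
      ≡⟨ sum-cong-≗ (λ i → trans (cong (p i *_) (∑-split l h (R i) l+h≡1)) (*-distribˡ-+ (p i) _ _)) ⟨
    sum (λ i → p i * sum (R i)) ≡⟨ sum-cong-≗ (λ i → on-support (p i) (R-rows i)) ⟩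
    sum (λ i → p i * 3) ≡⟨ *-distribʳ-sum 3 p ⟨
    sum p * 3 ∎
    where open ≡-Reasoning

  LL+LH+RL : W l l + W l h + RL ≡ sum (λ u → l u * (sum (a u) + sum (λ i → p i * R i u)))
  LL+LH+RL = begin
    W l l + W l h + RL ≡⟨ cong₂ _+_ (sym (W-split l h l l+h≡1)) RL′ ⟩
    sum (λ u → l u * sum (a u)) + sum (λ u → l u * sum (λ i → p i * R i u))
      ≡⟨ ∑-distrib-+ (λ u → l u * sum (a u)) _ ⟨
    sum (λ u → l u * sum (a u) + l u * sum (λ i → p i * R i u)) ≡⟨ sum-cong-≗ (λ u → *-distribˡ-+ (l u) _ _) ⟨
    sum (λ u → l u * (sum (a u) + sum (λ i → p i * R i u))) ∎
    where open ≡-Reasoning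

  row-≤ : ∀ u → l u * (sum (a u) + sum (λ i → p i * R i u)) ≤ l u * 3
  row-≤ u = on-support-≤ (l u) λ lu → +-mono-≤ (a-rows≤2 u lu) (R-cols≤1 u lu)

  -- `RL` is added on both sides to avoid subtraction: the bound `3 − r(u) ≥ deg(u)` is used in the
  -- form `deg(u) + r(u) ≤ 3` of `row-≤`.
  LL+LH≤PQ : W l l + W l h ≤ W p q
  LL+LH≤PQ = +-cancelʳ-≤ RL _ _ (begin
    W l l + W l h + RL ≡⟨ LL+LH+RL ⟩
    _                  ≤⟨ ∑-mono row-≤ ⟩
    sum (λ u → l u * 3) ≡⟨ *-distribʳ-sum 3 l ⟨
    sum l * 3 ≡⟨ cong (_* 3) ∑p≡∑l ⟨
    sum p * 3 ≡⟨ PQ+RL ⟨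
    RL + W p q ≡⟨ +-comm RL _ ⟩
    W p q + RL ∎)
    where open ≤-Reasoning

  -- Both splittings of the vertices count all ordered adjacent pairs, and the terms `W q q` and
  -- `W h h` cancel.
  PP+2PQ≡LL+2LH : W p p + 2 * W p q ≡ W l l + 2 * W l h
  PP+2PQ≡LL+2LH = +-cancelʳ-≡ (W q q) _ _ (trans (sym (total-split p q p+q≡1))
    (trans (total-split l h l+h≡1) (cong (W l l + 2 * W l h +_) (sym QQ≡HH))))

  -- Let `k` be the slack, `pq = ll + lh + k`. The equation then reads `pp + ll + 2 * k = 0`.
  squeeze : ∀ pp pq ll lh → pp + 2 * pq ≡ ll + 2 * lh → ll + lh ≤ pq → pp ≡ 0 × ll ≡ 0 × pq ≡ lh
  squeeze pp pq ll lh eq le with k , refl ← m≤n⇒∃[o]m+o≡n le = pp≡0 , ll≡0 , pq≡lh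
    where
    surplus : pp + ll + 2 * k ≡ 0
    surplus = +-cancelʳ-≡ (ll + 2 * lh) _ _ (trans (lem pp ll k lh) eq)
      where
      lem : ∀ pp ll k lh → pp + ll + 2 * k + (ll + 2 * lh) ≡ pp + 2 * (ll + lh + k)
      lem = solve-∀
    pp+ll≡0 : pp + ll ≡ 0
    pp+ll≡0 = m+n≡0⇒m≡0 (pp + ll) surplus
    pp≡0 : pp ≡ 0
    pp≡0 = m+n≡0⇒m≡0 pp pp+ll≡0
    ll≡0 : ll ≡ 0
    ll≡0 = m+n≡0⇒n≡0 pp pp+ll≡0
    pq≡lh : ll + lh + k ≡ lh
    pq≡lh = trans (cong₂ (λ x y → x + lh + y) ll≡0 (m+n≡0⇒m≡0 k (m+n≡0⇒n≡0 (pp + ll) surplus)))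
      (+-identityʳ lh)

  W≡0 : ∀ x y → W x y ≡ 0 → ∀ {i j} → x i ≢ 0 → y j ≢ 0 → a i j ≡ 0
  W≡0 x y eq {i} {j} xi yj =
    on-support⁻ (y j) yj (trans (∑≡0 (on-support⁻ (x i) xi (trans (∑≡0 eq i) (sym (*-zeroʳ (x i))))) j)
      (sym (*-zeroʳ (y j))))

  private
    squeezed : W p p ≡ 0 × W l l ≡ 0 × W p q ≡ W l h
    squeezed = squeeze (W p p) (W p q) (W l l) (W l h) PP+2PQ≡LL+2LH LL+LH≤PQ

  p-independent : ∀ {i j} → p i ≢ 0 → p j ≢ 0 → a i j ≡ 0
  p-independent = W≡0 p p (proj₁ squeezed)

  l-independent : ∀ {u v} → l u ≢ 0 → l v ≢ 0 → a u v ≡ 0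
  l-independent = W≡0 l l (proj₁ (proj₂ squeezed))

  -- As `W l l` vanishes and `W p q` equals `W l h`, the chain of `LL+LH≤PQ` consists of equalities.
  -- So each `u` in `l` attains the bound 3, which is possible only as 2 + 1.
  tight : ∀ u → l u ≢ 0 → sum (a u) ≡ 2 × sum (λ i → p i * R i u) ≡ 1
  tight u lu = pair (a-rows≤2 u lu) (R-cols≤1 u lu)
    (on-support⁻ (l u) lu (∑-tight row-≤ (begin
      _ ≡⟨ LL+LH+RL ⟨
      W l l + W l h + RL
        ≡⟨ cong₂ (λ x y → x + y + RL) (proj₁ (proj₂ squeezed)) (sym (proj₂ (proj₂ squeezed))) ⟩
      W p q + RL ≡⟨ +-comm (W p q) RL ⟩
      RL + W p q ≡⟨ PQ+RL ⟩
      sum p * 3 ≡⟨ cong (_* 3) ∑p≡∑l ⟩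
      sum l * 3 ≡⟨ *-distribʳ-sum 3 l ⟩
      sum (λ u → l u * 3) ∎) u))
    where
    open ≡-Reasoning
    pair : ∀ {x y} → x ≤ 2 → y ≤ 1 → x + y ≡ 3 → x ≡ 2 × y ≡ 1
    pair {x} {y} x≤2 y≤1 eq =
      ≤-antisym x≤2 (+-cancelʳ-≤ 1 2 x (≤-trans (≤-reflexive (sym eq)) (+-monoʳ-≤ x y≤1))) ,
      ≤-antisym y≤1 (+-cancelˡ-≤ 2 1 y (≤-trans (≤-reflexive (sym eq)) (+-monoˡ-≤ y x≤2)))

  -- By `tight` each vertex of `l` contributes 1 to `RL`, so `RL` is `sum l`, which is `sum p`. Rows
  -- bounded by 1 must then all equal 1.
  R-l-row : (∀ i → p i ≢ 0 → sum (λ u → l u * R i u) ≤ 1) → ∀ i → p i ≢ 0 → sum (λ u → l u * R i u) ≡ 1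
  R-l-row ≤1 i pi = on-support⁻ (p i) pi (∑-tight (λ i → on-support-≤ (p i) (≤1 i)) (begin
    RL ≡⟨ RL′ ⟩
    _ ≡⟨ sum-cong-≗ (λ u → on-support (l u) (λ lu → proj₂ (tight u lu))) ⟩
    sum (λ u → l u * 1) ≡⟨ *-distribʳ-sum 1 l ⟨
    sum l * 1 ≡⟨ cong (_* 1) ∑p≡∑l ⟨
    sum p * 1 ≡⟨ *-distribʳ-sum 1 p ⟩
    sum (λ i → p i * 1) ∎) i)
    where open ≡-Reasoning

-- The two implications

module Forward (Γ : FinGraph) (φ : C₃ (L (toGraph Γ)) ≅ toGraph Γ) where
  open BoundedDegree Γ φ
  open Subcubic Γ degree≤3

  ~⇒~L : ∀ {i j} → i ~ j → from i ~L from j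
  ~⇒~L {i} {j} e = adj-from {from i} {from j} (subst₂ _~_ (sym (to-from i)) (sym (to-from j)) e)

  ~L⇒~ : ∀ {i j} → from i ~L from j → i ~ j
  ~L⇒~ {i} {j} e = subst₂ _~_ (to-from i) (to-from j) (adj-to {from i} {from j} e)

  ~⇔~L : ∀ {i j} s t → from i ≈L s → from j ≈L t → (i ~ j → s ~L t) × (s ~L t → i ~ j)
  ~⇔~L {i} {j} s t p q =
    (λ e → ~L-resp {from i} {s} {from j} {t} p q (~⇒~L e)) ,
    (λ e → ~L⇒~ (~L-resp {s} {from i} {t} {from j} (≈L-sym (from i) s p) (≈L-sym (from j) t q) e))

  from-injective : ∀ {i j} → from i ≈L from j → i ≡ j
  from-injective {i} {j} eq = trans (sym (to-from i)) (trans (to-cong eq) (to-from j))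

  abstract
    -- This fixes, for each vertex of `Γ`, whether it stands for a claw or for a triangle. It is
    -- abstract since the arguments below work for any such choice.
    kind : ∀ i → View (from i)
    kind i = view (from i)

  isClaw isLine : ∀ {t} → View t → ℕ
  isClaw (claw _ _) = 1
  isClaw (line _ _) = 0
  isLine (claw _ _) = 0
  isLine (line _ _) = 1

  -- The rows of the matrices `M` and `R`: the first marks the centre of a claw, the second the
  -- corners of a triangle.
  centreAt cornerAt : ∀ {t} → View t → Vx → ℕ
  centreAt (claw {v} _ _) u = # (u ≟ v)
  centreAt (line _ _)     u = 0
  cornerAt (claw _ _)     u = 0
  cornerAt (line T _)     u = # (u ∈△? T)

  adj# : Vx → Vx → ℕ
  adj# i j = if E Γ i j then 1 else 0

  adj#-yes : ∀ {i j} → i ~ j → adj# i j ≡ 1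
  adj#-yes e = cong (λ b → if b then 1 else 0) e

  adj#-cong : ∀ {P : Set} (d : Dec P) {i j} → (i ~ j → P) → (P → i ~ j) → adj# i j ≡ # d
  adj#-cong (yes p) f g = adj#-yes (g p)
  adj#-cong (no ¬p) {i} {j} f g with E Γ i j
  ... | true  = contradiction (f refl) ¬p
  ... | false = refl

  low high : Vx → ℕ
  high u = # (degree Γ u ℕ.≟ 3)
  low  u = # (¬? (degree Γ u ℕ.≟ 3))

  low≢0⇒degree≤2 : ∀ {u} → low u ≢ 0 → degree Γ u ≤ 2
  low≢0⇒degree≤2 {u} l = s≤s⁻¹ (≤∧≢⇒< (degree≤3 u) (#≢0 (¬? (degree Γ u ℕ.≟ 3)) l))

  ≢3⇒low≢0 : ∀ {u} → degree Γ u ≢ 3 → low u ≢ 0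
  ≢3⇒low≢0 {u} ne eq with () ← trans (sym eq) (#-yes (¬? (degree Γ u ℕ.≟ 3)) ne)

  centreAt≢0 : ∀ {t} (k : View t) {u} → centreAt k u ≢ 0 → Σ (Claw u) λ c → t ≈L clawL c
  centreAt≢0 (claw {v} c eq) {u} ne with u ≟ v
  ... | yes refl = c , eq
  ... | no _     = contradiction refl ne
  centreAt≢0 (line _ _) ne = contradiction refl ne

  cornerAt≢0 : ∀ {t} (k : View t) {u} → cornerAt k u ≢ 0 → ∃ λ T → t ≈L lineL T × u ∈△ T
  cornerAt≢0 (claw _ _)  ne = contradiction refl ne
  cornerAt≢0 (line T eq) ne = T , eq , #≢0 (_ ∈△? T) ne

  corner#-split : ∀ T u → let open Triangle T in
                  # (u ∈△? T) ≡ # (u ≟ t₁) + (# (u ≟ t₂) + # (u ≟ t₃))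
  corner#-split (tri a b c p q r) u with u ≟ a | u ≟ b | u ≟ c
  ... | yes refl | yes refl | _        = contradiction refl (~⇒≢ p)
  ... | yes refl | no _     | yes refl = contradiction refl (~⇒≢ r)
  ... | yes refl | no _     | no _     = refl
  ... | no _     | yes refl | yes refl = contradiction refl (~⇒≢ q)
  ... | no _     | yes refl | no _     = refl
  ... | no _     | no _     | yes _    = refl
  ... | no _     | no _     | no _     = refl

  ∑-corners : ∀ (x : Vx → ℕ) T → let open Triangle T in
              sum (λ u → x u * # (u ∈△? T)) ≡ x t₁ + (x t₂ + x t₃)
  ∑-corners x T = begin
    sum (λ u → x u * # (u ∈△? T))
      ≡⟨ sum-cong-≗ (λ u → trans (cong (x u *_) (corner#-split T u)) (distrib (x u) _ _ _)) ⟩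
    sum (λ u → x u * # (u ≟ t₁) + (x u * # (u ≟ t₂) + x u * # (u ≟ t₃)))
      ≡⟨ ∑-distrib-+ (λ u → x u * # (u ≟ t₁)) _ ⟩
    sum (λ u → x u * # (u ≟ t₁)) + sum (λ u → x u * # (u ≟ t₂) + x u * # (u ≟ t₃))
      ≡⟨ cong (sum (λ u → x u * # (u ≟ t₁)) +_) (∑-distrib-+ (λ u → x u * # (u ≟ t₂)) _) ⟩
    sum (λ u → x u * # (u ≟ t₁)) + (sum (λ u → x u * # (u ≟ t₂)) + sum (λ u → x u * # (u ≟ t₃)))
      ≡⟨ cong₂ _+_ (∑-δ x t₁) (cong₂ _+_ (∑-δ x t₂) (∑-δ x t₃)) ⟩
    x t₁ + (x t₂ + x t₃) ∎
    where
    open ≡-Reasoning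
    open Triangle T
    distrib : ∀ a b c d → a * (b + (c + d)) ≡ a * b + (a * c + a * d)
    distrib a b c d = trans (*-distribˡ-+ a b (c + d)) (cong (a * b +_) (*-distribˡ-+ a c d))

  ∑-centre : ∀ {t} (k : View t) → sum (centreAt k) ≡ isClaw k
  ∑-centre (claw {v} _ _) = trans (sum-cong-≗ (λ u → sym (*-identityˡ (# (u ≟ v))))) (∑-δ (λ _ → 1) v)
  ∑-centre {t} (line T eq) = ∑-zero {f = centreAt {t} (line T eq)} (λ _ → refl)

  ∑-corner : ∀ {t} (k : View t) → isLine k ≢ 0 → sum (cornerAt k) ≡ 3
  ∑-corner (claw _ _) ne = contradiction refl ne
  ∑-corner (line T _) _  = trans (sum-cong-≗ (λ u → sym (*-identityˡ (# (u ∈△? T))))) (∑-corners (λ _ → 1) T)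

  centreAt≤1 : ∀ {t} (k : View t) u → centreAt k u ≤ 1
  centreAt≤1 (claw {v} _ _) u = #≤1 (u ≟ v)
  centreAt≤1 (line _ _)     u = z≤n

  cornerAt≤1 : ∀ {t} (k : View t) u → cornerAt k u ≤ 1
  cornerAt≤1 (claw _ _) u = z≤n
  cornerAt≤1 (line T _) u = #≤1 (u ∈△? T)

  isLine≤1 : ∀ {t} (k : View t) → isLine k ≤ 1
  isLine≤1 (claw _ _) = z≤n
  isLine≤1 (line _ _) = ≤-refl

  isLine-lineL : ∀ {t} (k : View t) T → t ≈L lineL T → isLine k ≡ 1
  isLine-lineL {t} (claw c eq) T eq' =
    contradiction (≈L-trans (clawL c) t (lineL T) (≈L-sym t (clawL c) eq) eq') (clawL≉lineL c T)
  isLine-lineL (line _ _) _ _ = refl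

  centreAt-clawL : ∀ {t u} (k : View t) (c : Claw u) → t ≈L clawL c → centreAt k u ≡ 1
  centreAt-clawL {t} {u} (claw {v} d eq) c eq' = #-yes (u ≟ v)
    (clawL≈⇒centre≡ c d (≈L-trans (clawL c) t (clawL d) (≈L-sym t (clawL c) eq') eq))
  centreAt-clawL {t} (line T eq) c eq' =
    contradiction (≈L-trans (clawL c) t (lineL T) (≈L-sym t (clawL c) eq') eq) (clawL≉lineL c T)

  cornerAt-lineL : ∀ {t} (k : View t) T → t ≈L lineL T → ∀ u → cornerAt k u ≡ # (u ∈△? T)
  cornerAt-lineL {t} (claw c eq) T eq' u =
    contradiction (≈L-trans (clawL c) t (lineL T) (≈L-sym t (clawL c) eq) eq') (clawL≉lineL c T)
  cornerAt-lineL {t} (line S eq) T eq' u = #-cong (u ∈△? S) (u ∈△? T) (proj₁ (S≈T u)) (proj₂ (S≈T u))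
    where
    S≈T : S ≈△ T
    S≈T = lineL≈⇒≈△ S T (≈L-trans (lineL S) t (lineL T) (≈L-sym t (lineL S) eq) eq')

  centre-unique : ∀ {u i j} → centreAt (kind i) u ≢ 0 → centreAt (kind j) u ≢ 0 → i ≡ j
  centre-unique {u} {i} {j} p q with c , eq ← centreAt≢0 (kind i) p | d , eq' ← centreAt≢0 (kind j) q =
    from-injective (≈L-trans (from i) (clawL d) (from j)
      (≈L-trans (from i) (clawL c) (clawL d) eq (clawL-unique c d)) (≈L-sym (from j) (clawL d) eq'))

  -- A vertex of degree 3 is the centre of exactly one claw up to equivalence, so its column has a
  -- single 1, at `to (clawL c)`. Any other vertex has no claw.
  ∑-centre-col : ∀ u → sum (λ i → centreAt (kind i) u) ≡ high u
  ∑-centre-col u with degree Γ u ℕ.≟ 3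
  ... | yes d≡3 = trans (∑≡1 _ (λ i → centreAt≤1 (kind i) u) centre-unique (to (clawL c))
                    (centreAt-clawL (kind (to (clawL c))) c (from-to (clawL c))))
                    (sym (#-yes (degree Γ u ℕ.≟ 3) d≡3))
    where
    c : Claw u
    c = degree≡3⇒claw d≡3
  ... | no d≢3  = trans (∑-zero λ i → zero-at (kind i)) (sym (#-no (degree Γ u ℕ.≟ 3) d≢3))
    where
    zero-at : ∀ {t} (k : View t) → centreAt k u ≡ 0
    zero-at (claw {v} c _) = #-no (u ≟ v) λ { refl → d≢3 (claw⇒degree≡3 c) }
    zero-at (line _ _)     = refl

  -- A vertex of degree at most 2 lies on at most one triangle, and that triangle is `from i` for
  -- only one `i`.
  corner-unique : ∀ {u i j} → low u ≢ 0 → cornerAt (kind i) u ≢ 0 → cornerAt (kind j) u ≢ 0 → i ≡ j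
  corner-unique {u} {i} {j} l p q
    with S , eq , u∈S ← cornerAt≢0 (kind i) p | T , eq' , u∈T ← cornerAt≢0 (kind j) q =
    from-injective (≈L-trans (from i) (lineL T) (from j)
      (≈L-trans (from i) (lineL S) (lineL T) eq
        (≈△⇒lineL≈ S T (degree≤2⇒△-unique S T (low≢0⇒degree≤2 l) u∈S u∈T)))
      (≈L-sym (from j) (lineL T) eq'))

  -- The claw at `u` shares an edge with a triangle exactly when `u` is one of its corners, and
  -- `from` preserves and reflects adjacency.
  centre~corner : ∀ i → isLine (kind i) ≢ 0 → ∀ j u → centreAt (kind j) u ≢ 0 → adj# i j ≡ cornerAt (kind i) u
  centre~corner i li j u m with kind i | centreAt≢0 (kind j) m
  ... | claw _ _  | _       = contradiction refl li
  ... | line T eq | c , eq' = adj#-cong (u ∈△? T)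
    (λ e → clawL~lineL⁻ c T (~L-sym (lineL T) (clawL c) (proj₁ (~⇔~L (lineL T) (clawL c) eq eq') e)))
    (λ u∈ → proj₂ (~⇔~L (lineL T) (clawL c) eq eq') (~L-sym (clawL c) (lineL T) (clawL~lineL⁺ c T u∈)))

  centre~centre : ∀ i u → centreAt (kind i) u ≢ 0 → ∀ j v → centreAt (kind j) v ≢ 0 → adj# i j ≡ adj# u v
  centre~centre i u m j v m' with c , eq ← centreAt≢0 (kind i) m | d , eq' ← centreAt≢0 (kind j) m' =
    trans (adj#-cong (E Γ u v Bool.≟ true)
             (λ e → clawL~clawL⁻ c d (proj₁ (~⇔~L (clawL c) (clawL d) eq eq') e))
             (λ e → proj₂ (~⇔~L (clawL c) (clawL d) eq eq') (clawL~clawL⁺ c d e)))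
          (sym (adj#-cong (E Γ u v Bool.≟ true) (λ e → e) (λ e → e)))

  degree≡∑ : ∀ u → degree Γ u ≡ sum (adj# u)
  degree≡∑ u = sum-allFin (adj# u)

  countingData : CountingData (n Γ)
  countingData = record
    { a = adj#
    ; M = λ i → centreAt (kind i)
    ; R = λ i → cornerAt (kind i)
    ; p = λ i → isLine (kind i)
    ; q = λ i → isClaw (kind i)
    ; l = low
    ; h = high
    ; a-sym = λ i j → cong (λ b → if b then 1 else 0) (E-sym Γ i j)
    ; p+q≡1 = λ i → line+claw (kind i)
    ; l+h≡1 = λ u → #-¬? (degree Γ u ℕ.≟ 3)
    ; M-rows = λ i → ∑-centre (kind i)
    ; M-cols = ∑-centre-col
    ; M-a = centre~centre
    ; R-rows = λ i → ∑-corner (kind i)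
    ; M-R = centre~corner
    ; R-cols≤1 = λ u lu → ∑≤1 _ (λ i → *-mono-≤ (isLine≤1 (kind i)) (cornerAt≤1 (kind i) u))
        (λ {i} {j} p q → corner-unique lu (proj₂ (*-≢0 (isLine (kind i)) p))
                                          (proj₂ (*-≢0 (isLine (kind j)) q)))
    ; a-rows≤2 = λ u lu → ≤-trans (≤-reflexive (sym (degree≡∑ u))) (low≢0⇒degree≤2 lu)
    }
    where
    line+claw : ∀ {t} (k : View t) → isLine k + isClaw k ≡ 1
    line+claw (claw _ _) = refl
    line+claw (line _ _) = refl
    #-¬? : ∀ {P : Set} (d : Dec P) → # (¬? d) + # d ≡ 1
    #-¬? (yes _) = refl
    #-¬? (no _)  = refl

  open Count countingData

  cond1 : Cond1 Γ
  cond1 v with degree Γ v ℕ.≟ 3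
  ... | yes d≡3 = inj₂ d≡3
  ... | no d≢3  = inj₁ (trans (degree≡∑ v) (proj₁ (tight v (≢3⇒low≢0 d≢3))))

  degree≡2⇒≢3 : ∀ {v} → degree Γ v ≡ 2 → degree Γ v ≢ 3
  degree≡2⇒≢3 d≡2 d≡3 with () ← trans (sym d≡2) d≡3

  cond2 : Cond2 Γ
  cond2 v d≡2
    -- The column sum at `v` is 1, so some row is nonzero there, and that row comes from a triangle
    -- through `v`.
    with i , pR≢0 ← ∑≢0 _ (λ z → 0≢1+n (trans (sym z) (proj₂ (tight v (≢3⇒low≢0 (degree≡2⇒≢3 d≡2))))))
    with T , _ , v∈T ← cornerAt≢0 (kind i) (proj₂ (*-≢0 (isLine (kind i)) pR≢0)) = T , v∈T

  deg2≡low : ∀ v → deg2 Γ v ≡ low v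
  deg2≡low v with cond1 v
  ... | inj₁ d≡2 = trans (cong (λ d → if d ≡ᵇ 2 then 1 else 0) d≡2)
    (sym (#-yes (¬? (degree Γ v ℕ.≟ 3)) (degree≡2⇒≢3 d≡2)))
  ... | inj₂ d≡3 = trans (cong (λ d → if d ≡ᵇ 2 then 1 else 0) d≡3)
    (sym (#-no (¬? (degree Γ v ℕ.≟ 3)) (λ d≢3 → d≢3 d≡3)))

  isLine-to-lineL : ∀ T → isLine (kind (to (lineL T))) ≢ 0
  isLine-to-lineL T eq = 0≢1+n (trans (sym eq) (isLine-lineL (kind (to (lineL T))) T (from-to (lineL T))))

  -- Two such corners would be adjacent vertices of `l`, against `l-independent`.
  low-corner-unique : ∀ i {u v} → low u * cornerAt (kind i) u ≢ 0 → low v * cornerAt (kind i) v ≢ 0 → u ≡ v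
  low-corner-unique i {u} {v} p q with u ≟ v
  ... | yes u≡v = u≡v
  ... | no u≢v with lu , cu ← *-≢0 (low u) p | lv , cv ← *-≢0 (low v) q
    with T , eq , u∈T ← cornerAt≢0 (kind i) cu =
    contradiction (trans (sym (l-independent lu lv)) (adj#-yes (△-clique T u∈T v∈T u≢v))) 0≢1+n
    where
    v∈T : v ∈△ T
    v∈T = #≢0 (v ∈△? T) (subst (_≢ 0) (cornerAt-lineL (kind i) T eq v) cv)

  cond3 : Cond3 Γ
  cond3 T@(tri a b c _ _ _) = begin
    deg2 Γ a + deg2 Γ b + deg2 Γ c ≡⟨ cong₂ _+_ (cong₂ _+_ (deg2≡low a) (deg2≡low b)) (deg2≡low c) ⟩
    low a + low b + low c          ≡⟨ +-assoc (low a) (low b) (low c) ⟩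
    low a + (low b + low c)        ≡⟨ ∑-corners low T ⟨
    sum (λ u → low u * # (u ∈△? T))
      ≡⟨ sum-cong-≗ (λ u → cong (low u *_) (cornerAt-lineL (kind i) T (from-to (lineL T)) u)) ⟨
    sum (λ u → low u * cornerAt (kind i) u)
      -- `low-corner-unique` allows at most one low corner per triangle, which `R-l-row` sharpens to
      -- exactly one.
      ≡⟨ R-l-row (λ i _ → ∑≤1 _
           (λ u → *-mono-≤ (#≤1 (¬? (degree Γ u ℕ.≟ 3))) (cornerAt≤1 (kind i) u))
           (low-corner-unique i)) i (isLine-to-lineL T) ⟩
    1 ∎
    where
    open ≡-Reasoning
    i : Vx
    i = to (lineL T)

  -- Distinct triangles that meet would have adjacent images under `to`, both marked by `p`, against
  -- `p-independent`.
  cond4 : Cond4 Γ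
  cond4 S T S≉T (x , x∈S , x∈T) = 0≢1+n (trans
    (sym (p-independent (isLine-to-lineL S) (isLine-to-lineL T)))
    (adj#-yes (adj-to {lineL S} {lineL T} (meeting⇒lineL~lineL S T x∈S x∈T S≉T))))

-- From the four conditions to the isomorphism

module Backward (Γ : FinGraph) (cond1 : Cond1 Γ) (cond2 : Cond2 Γ) (cond3 : Cond3 Γ) (cond4 : Cond4 Γ) where
  open Adjacency Γ

  degree≤3 : ∀ v → degree Γ v ≤ 3
  degree≤3 v = [ (λ d≡2 → ≤-trans (≤-reflexive d≡2) (n≤1+n 2)) , ≤-reflexive ] (cond1 v)

  open Subcubic Γ degree≤3

  degree≡2⇒deg2≡1 : ∀ {v} → degree Γ v ≡ 2 → deg2 Γ v ≡ 1
  degree≡2⇒deg2≡1 d≡2 = cong (λ d → if d ≡ᵇ 2 then 1 else 0) d≡2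

  degree≡3⇒deg2≡0 : ∀ {v} → degree Γ v ≡ 3 → deg2 Γ v ≡ 0
  degree≡3⇒deg2≡0 d≡3 = cong (λ d → if d ≡ᵇ 2 then 1 else 0) d≡3

  -- Two distinct corners of degree 2 would make the sum in `cond3` at least 2. The variants of
  -- `clash` cover the three positions of such a pair.
  low-unique : ∀ {u v} T → degree Γ u ≡ 2 → degree Γ v ≡ 2 → u ∈△ T → v ∈△ T → u ≡ v
  low-unique {u} {v} T du dv u∈T v∈T = go T u∈T v∈T (cond3 T) (degree≡2⇒deg2≡1 du) (degree≡2⇒deg2≡1 dv)
    where
    clash : ∀ {x y z} → x ≡ 1 → y ≡ 1 → x + y + z ≢ 1
    clash refl refl ()
    clash′ : ∀ {x y z} → x ≡ 1 → z ≡ 1 → x + y + z ≢ 1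
    clash′ {y = zero}  refl refl ()
    clash′ {y = suc y} refl refl ()
    clash″ : ∀ {x y z} → y ≡ 1 → z ≡ 1 → x + y + z ≢ 1
    clash″ {zero}        refl refl ()
    clash″ {suc zero}    refl refl ()
    clash″ {suc (suc x)} refl refl ()
    go : ∀ T → u ∈△ T → v ∈△ T →
         deg2 Γ (Triangle.t₁ T) + deg2 Γ (Triangle.t₂ T) + deg2 Γ (Triangle.t₃ T) ≡ 1 →
         deg2 Γ u ≡ 1 → deg2 Γ v ≡ 1 → u ≡ v
    go T 1st 1st c p q = refl
    go T 1st 2nd c p q = contradiction c (clash p q)
    go T 1st 3rd c p q = contradiction c (clash′ {y = deg2 Γ (Triangle.t₂ T)} p q)
    go T 2nd 1st c p q = contradiction c (clash q p)
    go T 2nd 2nd c p q = refl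
    go T 2nd 3rd c p q = contradiction c (clash″ {deg2 Γ (Triangle.t₁ T)} p q)
    go T 3rd 1st c p q = contradiction c (clash′ {y = deg2 Γ (Triangle.t₂ T)} q p)
    go T 3rd 2nd c p q = contradiction c (clash″ {deg2 Γ (Triangle.t₁ T)} q p)
    go T 3rd 3rd c p q = refl

  low-exists : ∀ T → ∃ λ v → degree Γ v ≡ 2 × v ∈△ T
  low-exists T@(tri a b c _ _ _) with cond1 a | cond1 b | cond1 c
  ... | inj₁ d | _      | _      = a , d , 1st
  ... | inj₂ _ | inj₁ d | _      = b , d , 2nd
  ... | inj₂ _ | inj₂ _ | inj₁ d = c , d , 3rd
  ... | inj₂ p | inj₂ q | inj₂ r with () ← trans (sym (cond3 T))
        (cong₂ _+_ (cong₂ _+_ (degree≡3⇒deg2≡0 p) (degree≡3⇒deg2≡0 q)) (degree≡3⇒deg2≡0 r))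

  data Image (v : Vx) : Set where
    claw : Claw v → Image v
    line : degree Γ v ≡ 2 → ∀ T → v ∈△ T → Image v

  image : ∀ v → Image v
  image v with cond1 v
  ... | inj₁ d≡2 = let T , v∈T = cond2 v d≡2 in line d≡2 T v∈T
  ... | inj₂ d≡3 = claw (degree≡3⇒claw d≡3)

  toL : ∀ {v} → Image v → Triangle LG
  toL (claw c)     = clawL c
  toL (line _ T _) = lineL T

  -- A claw determines its centre, and by `low-unique` a triangle determines its vertex of degree 2.
  toL-injective : ∀ {v w} (s : Image v) (t : Image w) → toL s ≈L toL t → v ≡ w
  toL-injective (claw c) (claw d) eq = clawL≈⇒centre≡ c d eq
  toL-injective (claw c) (line _ T _) eq = contradiction eq (clawL≉lineL c T)
  toL-injective (line _ S _) (claw d) eq = contradiction (≈L-sym (lineL S) (clawL d) eq) (clawL≉lineL d S)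
  toL-injective (line dv S v∈S) (line dw T w∈T) eq =
    low-unique T dv dw (proj₁ (lineL≈⇒≈△ S T eq _) v∈S) w∈T

  clawL≈toL : ∀ {v} (c : Claw v) (s : Image v) → toL s ≈L clawL c
  clawL≈toL c (claw d)      = clawL-unique d c
  clawL≈toL c (line d≡2 T _) with () ← trans (sym d≡2) (claw⇒degree≡3 c)

  lineL≈toL : ∀ {v} T → degree Γ v ≡ 2 → v ∈△ T → (s : Image v) → toL s ≈L lineL T
  lineL≈toL T d≡2 v∈T (claw c) with () ← trans (sym d≡2) (claw⇒degree≡3 c)
  lineL≈toL T d≡2 v∈T (line _ S v∈S) =
    ≈△⇒lineL≈ S T (degree≤2⇒△-unique S T (≤-reflexive d≡2) v∈S v∈T)

  toL-surjective : ∀ t → ∃ λ v → toL (image v) ≈L t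
  toL-surjective t with view t
  ... | claw {v} c eq =
    v , ≈L-trans (toL (image v)) (clawL c) t (clawL≈toL c (image v)) (≈L-sym t (clawL c) eq)
  ... | line T eq with v , d≡2 , v∈T ← low-exists T =
    v , ≈L-trans (toL (image v)) (lineL T) t (lineL≈toL T d≡2 v∈T (image v)) (≈L-sym t (lineL T) eq)

  ~⇒toL~ : ∀ {v w} (s : Image v) (t : Image w) → v ~ w → toL s ~L toL t
  ~⇒toL~ (claw c) (claw d) e = clawL~clawL⁺ c d e
  ~⇒toL~ (claw c) (line d≡2 T w∈T) e =
    clawL~lineL⁺ c T (degree≤2⇒nbr∈△ T (≤-reflexive d≡2) w∈T (~-sym e))
  ~⇒toL~ (line d≡2 S v∈S) (claw d) e = ~L-sym (clawL d) (lineL S)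
    (clawL~lineL⁺ d S (degree≤2⇒nbr∈△ S (≤-reflexive d≡2) v∈S e))
  -- Adjacent vertices of degree 2 would lie on a common triangle, against `low-unique`.
  ~⇒toL~ (line dv S v∈S) (line dw T w∈T) e =
    contradiction (low-unique S dv dw v∈S (degree≤2⇒nbr∈△ S (≤-reflexive dv) v∈S e)) (~⇒≢ e)

  claw-line-~ : ∀ {v w} (c : Claw v) T → degree Γ w ≡ 2 → w ∈△ T → clawL c ~L lineL T → v ~ w
  claw-line-~ c T d≡2 w∈T a = △-clique T (clawL~lineL⁻ c T a) w∈T
    λ { refl → contradiction (trans (sym d≡2) (claw⇒degree≡3 c)) λ () }

  toL~⇒~ : ∀ {v w} (s : Image v) (t : Image w) → toL s ~L toL t → v ~ w
  toL~⇒~ (claw c) (claw d) a = clawL~clawL⁻ c d a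
  toL~⇒~ (claw c) (line d≡2 T w∈T) a = claw-line-~ c T d≡2 w∈T a
  toL~⇒~ (line d≡2 S v∈S) (claw d) a = ~-sym (claw-line-~ d S d≡2 v∈S (~L-sym (lineL S) (clawL d) a))
  -- Distinct triangles with a common side would share its endpoints, which `cond4` excludes.
  toL~⇒~ (line _ S _) (line _ T _) (S≉T , e , e∈S , e∈T) =
    contradiction (Edge.e₁ e , proj₁ (∈-lineL⁻ S (joins (Edge.adj e)) e∈S)
                             , proj₁ (∈-lineL⁻ T (joins (Edge.adj e)) e∈T))
      (cond4 S T (λ eq → S≉T (≈△⇒lineL≈ S T eq)))

  iso : C₃ LG ≅ G
  iso = record
    { to        = to
    ; from      = from
    -- `to` chooses preimages; it respects equivalence because `toL` is injective.
    ; to-cong   = λ {s} {t} eq → toL-injective (image (to s)) (image (to t))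
        (≈L-trans (from (to s)) t (from (to t)) (≈L-trans (from (to s)) s t (from-to s) eq)
          (≈L-sym (from (to t)) t (from-to t)))
    ; from-cong = λ { {v} refl → ≈L-refl (from v) }
    ; from-to   = from-to
    ; to-from   = λ v → toL-injective (image (to (from v))) (image v) (from-to (from v))
    ; adj-to    = λ {s} {t} a → toL~⇒~ (image (to s)) (image (to t))
        (~L-resp {s} {from (to s)} {t} {from (to t)}
          (≈L-sym (from (to s)) s (from-to s)) (≈L-sym (from (to t)) t (from-to t)) a)
    ; adj-from  = λ {s} {t} e → ~L-resp {from (to s)} {s} {from (to t)} {t} (from-to s) (from-to t)
        (~⇒toL~ (image (to s)) (image (to t)) e)
    }
    where
    from : Vx → Triangle LG
    from v = toL (image v)
    to : Triangle LG → Vx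
    to t = proj₁ (toL-surjective t)
    from-to : ∀ t → from (to t) ≈L t
    from-to t = proj₂ (toL-surjective t)
    ≈L-refl : ∀ t → t ≈L t
    ≈L-refl t x = (λ z → z) , (λ z → z)

theorem6 : (Γ : FinGraph) → Connected Γ →
    ((C₃ (L (toGraph Γ)) ≅ toGraph Γ) ⇔ (Cond1 Γ × Cond2 Γ × Cond3 Γ × Cond4 Γ))
theorem6 Γ _ = mk⇔
  (λ φ → let open Forward Γ φ in cond1 , cond2 , cond3 , cond4)
  (λ (c1 , c2 , c3 , c4) → Backward.iso Γ c1 c2 c3 c4)
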